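{- Let $\mathcal{N} = \langle V_{min}, V_{max}, E, L\rangle$ be a finite minimax net. Given $\mathcal{N}$ as input, Algorithm 1 (written out in the context) returns the greatest correct marking of $\mathcal{N}$ under the Gödel semantics. Moreover, assuming that the nodes in $V_{min}$ are sorted according to $L$ and that the positive edges in $V_{min} \times V_{max}$ are sorted according to $E$, Algorithm 1 can be implemented to run in linear time in $m$ and $n$ (that is, in time $O(m+n)$), where $m = |E|$ is the number of positive edges of $\mathcal{N}$ and $n = |V_{min} \cup V_{max}|$.
   Context: Gödel structure on $[0,1]$: $a \land b = \min(a,b)$, $a \lor b = \max(a,b)$, $a \otimes b = \min(a,b)$, and $(a \Rightarrow b) = b$ if $a > b$, and $(a \Rightarrow b) = 1$ otherwise. Infima and suprema ($\bigwedge$, $\bigvee$) are taken in $[0,1]$ (so $\bigwedge\emptyset = 1$, $\bigvee\emptyset = 0$). A fuzzy subset of a set $X$ is a function $X \to [0,1]$; fuzzy subsets are ordered pointwise. A (fuzzy) minimax net is a structure $\mathcal{N} = \langle V_{min}, V_{max}, E, L\rangle$, where $V_{min}$ and $V_{max}$ are non-empty disjoint sets of nodes (min-nodes and max-nodes), $E: (V_{min} \times V_{max}) \cup (V_{max} \times V_{min}) \to [0,1]$ is a fuzzy set of edges, and $L: V_{min} \to [0,1]$ is the marking limit for min-nodes. One sets $E(x,y)=0$ for $\langle x,y\rangle \in (V_{min}\times V_{min}) \cup (V_{max} \times V_{max})$. A positive edge is a pair $\langle x,y\rangle \in (V_{min} \times V_{max}) \cup (V_{max} \times V_{min})$ with $E(x,y)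 > 0$; $|E|$ denotes the number of positive edges. A marking of $\mathcal{N}$ is a function $M: V_{min} \cup V_{max} \to [0,1]$. It is a correct marking if for every $x \in V_{min}$ and $y \in V_{max}$: $M(x) \leq L(x)$; $M(x) \leq \bigwedge_{z \in V_{max}} (E(z,x) \Rightarrow M(z))$; and $M(y) \leq \bigvee_{z \in V_{min}} (E(z,y) \otimes M(z))$. The greatest correct marking is the correct marking that is pointwise greater than or equal to every correct marking. Notation: $V = V_{min}\cup V_{max}$, $\mathit{Succ}(x) = \{y \in V \mid E(x,y)>0\}$, $\mathit{Pred}(x) = \{y\in V \mid E(y,x)>0\}$. Algorithm 1 (input: a finite minimax net $\mathcal{N}$; it maintains a marking $M$, Boolean flags $x.\mathit{done}$ for $x \in V_{min}$ and $\langle z,y\rangle.\mathit{done}$ for positive edges $\langle z,y\rangle \in V_{min}\times V_{max}$, counters $y.\mathit{count}$ for $y \in V_{max}$, and a priority queue $Q$ of nodes and edges in which smaller keys have higher priority; a node may occur in $Q$ several times, and each occurrence keeps the key it was inserted with). Initialization: $Q$ is empty. For each $x \in V_{min}$: $M(x) := L(x)$, $x.\mathit{done} := \mathit{false}$, insert $x$ into $Q$ with key $M(x)$. For each $y \in V_{max}$: $M(y) := 0$, $y.\mathit{count} := |\mathit{Pred}(y)|$, and if $y.\mathit{count} = 0$ insert $y$ into $Q$ with key $M(y)$. For each $\langle z,y\rangle \in V_{min}\times V_{max}$ with $E(z,y) > 0$: $\langle z,y\rangle.\mathit{done} := \mathit{false}$, insert $\langle z,y\rangle$ into $Q$ with key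 $E(z,y)$. Main loop: while $Q$ is not empty, extract from $Q$ an object $\mathit{obj}$ (an occurrence with smallest key, ties broken arbitrarily), and: (1) if $\mathit{obj}$ is a node $z \in V_{max}$: for each $x \in \mathit{Succ}(z)$ with $\lnot x.\mathit{done}$ and $E(z,x) > M(z)$, set $M(x) := M(z)$ and insert $x$ into $Q$ with key $M(x)$; (2) else if $\mathit{obj}$ is a node $z \in V_{min}$ with $\lnot z.\mathit{done}$: for each $y \in \mathit{Succ}(z)$ with $\lnot\langle z,y\rangle.\mathit{done}$, set $M(y) := M(z)$, $\langle z,y\rangle.\mathit{done} := \mathit{true}$, $y.\mathit{count} := y.\mathit{count}-1$, and if $y.\mathit{count}=0$ insert $y$ into $Q$ with key $M(y)$; after this, set $z.\mathit{done} := \mathit{true}$; (3) else if $\mathit{obj}$ is an edge $\langle z,y\rangle$ with $\lnot\langle z,y\rangle.\mathit{done}$: set $M(y) := E(z,y)$, $\langle z,y\rangle.\mathit{done} := \mathit{true}$, $y.\mathit{count} := y.\mathit{count}-1$, and if $y.\mathit{count} = 0$ insert $y$ into $Q$ with key $M(y)$. (Otherwise the extracted object is ignored.) When the loop terminates, return $M$. -}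

module Defs where

open import Algebra.Core using (Op₂)
open import Data.Bool.Base using (Bool; true; false; not; _∧_; if_then_else_)
open import Data.Fin.Base using (Fin; toℕ)
import Data.Fin.Properties as Fin
open import Data.List.Base
  using (List; []; _∷_; _++_; map; filter; foldl; length; lookup; allFin; cartesianProduct)
open import Data.List.Relation.Binary.Permutation.Propositional using (_↭_)
open import Data.List.Relation.Unary.All using (All)
import Data.List.Relation.Unary.Sorted.TotalOrder as SortedList
open import Data.Nat.Base as ℕ using (ℕ; zero; suc; pred; NonZero; _≡ᵇ_; _<ᵇ_)
import Data.Nat.Properties as ℕ
open import Data.Product.Base using (Σ; Σ-syntax; ∃-syntax; _×_; _,_; proj₁; proj₂)
import Data.Product.Properties as Product
open import Data.Sum.Base using (_⊎_; inj₁; inj₂)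
import Data.Sum.Properties as Sum
import Data.Vec.Functional as Vector
open import Function.Base using (flip)
open import Induction.WellFounded using (Acc)
open import Level as Level using (_⊔_)
open import Relation.Binary.Bundles using (DecTotalOrder; StrictTotalOrder)
import Relation.Binary.Construct.On as On
open import Relation.Binary.Construct.Closure.ReflexiveTransitive using (Star)
open import Relation.Binary.Definitions using (DecidableEquality; Minimum; Maximum)
open import Relation.Binary.PropositionalEquality.Core using (_≡_; _≢_)
open import Relation.Nullary.Decidable.Core using (does)

update : ∀ {a b} {A : Set a} {B : Set b} →
         DecidableEquality A → A → B → (A → B) → (A → B)
update _≟_ x v f y = if does (y ≟ x) then v else f y

-- The set of truth values.  The Gödel operations and the algorithm use
-- nothing of the real interval [0,1] beyond its order, its two end points
-- and the ability to compare two values, so any linear order with end points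
-- and decidable comparison may play the role of [0,1].
record BoundedChain c ℓ₁ ℓ₂ : Set (Level.suc (c ⊔ ℓ₁ ⊔ ℓ₂)) where
  field
    decTotalOrder : DecTotalOrder c ℓ₁ ℓ₂
  open DecTotalOrder decTotalOrder public
  field
    0# 1#   : Carrier
    minimum : Minimum _≤_ 0#
    maximum : Maximum _≤_ 1#

-- In particular, the closed interval [0,1] of any such order.
interval : ∀ {c ℓ₁ ℓ₂} (O : DecTotalOrder c ℓ₁ ℓ₂) → let open DecTotalOrder O in
           ∀ {lo hi} → lo ≤ hi → BoundedChain (c ⊔ ℓ₂) ℓ₁ ℓ₂
interval O {lo} {hi} lo≤hi = record
  { decTotalOrder = On.decTotalOrder O (proj₁ {B = λ a → (lo ≤ a) × (a ≤ hi)})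
  ; 0#            = lo , refl , lo≤hi
  ; 1#            = hi , lo≤hi , refl
  ; minimum       = λ (_ , lo≤a , _) → lo≤a
  ; maximum       = λ (_ , _ , a≤hi) → a≤hi
  }
  where open DecTotalOrder O

----------------------------------------------------------------------
-- Machine model: a unit-cost RAM with finitely many natural-number
-- registers and (for each program) finitely many arrays, holding either
-- natural numbers or truth values.  Numbers can only be copied, compared,
-- incremented and decremented; truth values can only be copied and
-- compared.

Name : Set
Name = ℕ

data Exp : Set where
  lit   : ℕ → Exp
  var   : Name → Exp
  _[_]  : Name → Exp → Exp
  inc dec : Exp → Exp

data VExp : Set where
  bottom : VExp
  _[_]   : Name → Exp → VExp

data Test : Set where
  _==_ _<<_ : Exp → Exp → Test
  _≼_       : VExp → VExp → Test
  neg       : Test → Test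
  _&&_      : Test → Test → Test

infixr 2 _⨾_

data Cmd : Set where
  skip       : Cmd
  _:=_       : Name → Exp → Cmd
  _[_]:=_    : Name → Exp → Exp → Cmd
  _[_]:=ᵛ_   : Name → Exp → VExp → Cmd
  _⨾_        : Cmd → Cmd → Cmd
  cond       : Test → Cmd → Cmd → Cmd
  while      : Test → Cmd → Cmd

-- An implementation of a loop: initialisation, loop test and loop body.
record Program : Set where
  field
    init  : Cmd
    guard : Test
    body  : Cmd

  command : Cmd
  command = init ⨾ while guard body

-- Registers and arrays holding the input.
pattern #min = 0      -- |Vmin|
pattern #max = 1      -- |Vmax|
pattern #up = 2       -- number of positive edges in Vmin × Vmax
pattern #down = 3     -- number of positive edges in Vmax × Vmin

pattern order = 0     -- the min-nodes, by increasing L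
pattern upSrc = 1     -- the positive edges in Vmin × Vmax, by increasing E:
pattern upTgt = 2     --   source and target
pattern downSrc = 3   -- the positive edges in Vmax × Vmin:
pattern downTgt = 4   --   source and target

pattern limitᵛ = 0    -- L
pattern upᵛ = 1       -- E at the listed edges in Vmin × Vmax
pattern downᵛ = 2     -- E at the listed edges in Vmax × Vmin

-- Arrays holding the variables of the algorithm.
pattern doneᵃ = 5
pattern edgeDoneᵃ = 6 -- indexed by position in the list of edges
pattern countᵃ = 7

pattern Mminᵛ = 3
pattern Mmaxᵛ = 4

module Minimax {c ℓ₁ ℓ₂} (chain : BoundedChain c ℓ₁ ℓ₂) where

  open BoundedChain chain public
  open import Relation.Binary.Properties.DecTotalOrder decTotalOrder public
    using (_<_; <-strictTotalOrder)
  open StrictTotalOrder <-strictTotalOrder public using (_<?_)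
  open import Algebra.Construct.NaturalChoice.Min totalOrder public using (_⊓_)
  open import Algebra.Construct.NaturalChoice.Max totalOrder public
    using () renaming (_⊔_ to _⊔#_)

  open SortedList totalOrder public using (Sorted)

  ----------------------------------------------------------------------
  -- Gödel structure

  infixr 7 _⊗_
  infixr 5 _⇒_

  _⊗_ : Op₂ Carrier
  _⊗_ = _⊓_

  _⇒_ : Op₂ Carrier
  a ⇒ b = if does (b <? a) then b else 1#

  ⋀ ⋁ : ∀ {k} → (Fin k → Carrier) → Carrier
  ⋀ = Vector.foldr _⊓_ 1#
  ⋁ = Vector.foldr _⊔#_ 0#

  ----------------------------------------------------------------------
  -- Finite minimax nets

  positives : ∀ {k l} → (Fin k → Fin l → Carrier) → List (Fin k × Fin l)
  positives {k} {l} F =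
    filter (λ e → 0# <? F (proj₁ e) (proj₂ e)) (cartesianProduct (allFin k) (allFin l))

  record Net : Set c where
    field
      p q : ℕ
      ⦃ p-nonZero ⦄ : NonZero p
      ⦃ q-nonZero ⦄ : NonZero q

    Vmin : Set
    Vmin = Fin p

    Vmax : Set
    Vmax = Fin q

    V : Set
    V = Vmin ⊎ Vmax

    -- The two restrictions of E; E is 0 on pairs of nodes of the same kind,
    -- so those pairs contribute no positive edge.
    field
      E⁻⁺ : Vmin → Vmax → Carrier
      E⁺⁻ : Vmax → Vmin → Carrier
      L   : Vmin → Carrier

    succ⁻ : Vmin → List Vmax
    succ⁻ z = filter (λ y → 0# <? E⁻⁺ z y) (allFin q)

    succ⁺ : Vmax → List Vmin
    succ⁺ z = filter (λ x → 0# <? E⁺⁻ z x) (allFin p)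

    pred⁺ : Vmax → List Vmin
    pred⁺ y = filter (λ z → 0# <? E⁻⁺ z y) (allFin p)

    edges⁻⁺ : List (Vmin × Vmax)
    edges⁻⁺ = positives E⁻⁺

    edges⁺⁻ : List (Vmax × Vmin)
    edges⁺⁻ = positives E⁺⁻

    #nodes : ℕ
    #nodes = p ℕ.+ q

    #edges : ℕ
    #edges = length edges⁻⁺ ℕ.+ length edges⁺⁻

  module _ (N : Net) where
    open Net N

    Marking : Set c
    Marking = V → Carrier

    record Correct (M : Marking) : Set ℓ₂ where
      field
        limit : ∀ x → M (inj₁ x) ≤ L x
        min   : ∀ x → M (inj₁ x) ≤ ⋀ (λ z → E⁺⁻ z x ⇒ M (inj₂ z))
        max   : ∀ y → M (inj₂ y) ≤ ⋁ (λ z → E⁻⁺ z y ⊗ M (inj₁ z))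

    IsGreatestCorrect : Marking → Set (c ⊔ ℓ₂)
    IsGreatestCorrect M = Correct M × (∀ M′ → Correct M′ → ∀ v → M′ v ≤ M v)

  ----------------------------------------------------------------------
  -- Algorithm 1, as a nondeterministic transition system

  module Algorithm (N : Net) where
    open Net N

    _≟V_ : DecidableEquality V
    _≟V_ = Sum.≡-dec Fin._≟_ Fin._≟_

    _≟E_ : DecidableEquality (Vmin × Vmax)
    _≟E_ = Product.≡-dec Fin._≟_ Fin._≟_

    data Obj : Set where
      node : V → Obj
      edge : Vmin → Vmax → Obj

    -- Q is a multiset of occurrences with their keys: the order of the list
    -- is immaterial.  edgeDone is only consulted at positive edges.
    record State : Set c where
      field
        M        : Marking N
        done     : Vmin → Bool
        edgeDone : Vmin × Vmax → Bool
        count    : Vmax → ℕ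
        Q        : List (Obj × Carrier)
    open State public

    initial : State
    initial = record
      { M        = M₀
      ; done     = λ _ → false
      ; edgeDone = λ _ → false
      ; count    = count₀
      ; Q        = map (λ x → node (inj₁ x) , M₀ (inj₁ x)) (allFin p)
                ++ map (λ y → node (inj₂ y) , M₀ (inj₂ y))
                       (filter (λ y → count₀ y ℕ.≟ 0) (allFin q))
                ++ map (λ (z , y) → edge z y , E⁻⁺ z y) edges⁻⁺
      }
      where
      M₀ : Marking N
      M₀ (inj₁ x) = L x
      M₀ (inj₂ _) = 0#
      count₀ : Vmax → ℕ
      count₀ y = length (pred⁺ y)

    insert : V → State → State
    insert v s = record s { Q = (node v , M s v) ∷ Q s }

    mark : V → Carrier → State → State
    mark v a s = record s { M = update _≟V_ v a (M s) }

    relax : Vmax → State → Vmin → State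
    relax z s x =
      if not (done s x) ∧ does (M s (inj₂ z) <? E⁺⁻ z x)
      then insert (inj₁ x) (mark (inj₁ x) (M s (inj₂ z)) s)
      else s

    finishEdge : Vmin → Vmax → Carrier → State → State
    finishEdge z y a s = if count s′ y ≡ᵇ 0 then insert (inj₂ y) s′ else s′
      where
      s′ : State
      s′ = record (mark (inj₂ y) a s)
        { edgeDone = update _≟E_ (z , y) true (edgeDone s)
        ; count    = update Fin._≟_ y (pred (count s y)) (count s)
        }

    visit : Vmin → State → Vmax → State
    visit z s y =
      if edgeDone s (z , y) then s else finishEdge z y (M s (inj₁ z)) s

    finishNode : Vmin → State → State
    finishNode z s = record s { done = update Fin._≟_ z true (done s) }

    -- The successors may be traversed in any order.
    data Process : Obj → State → State → Set c where
      max-node  : ∀ {z s xs} → xs ↭ succ⁺ z →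
                  Process (node (inj₂ z)) s (foldl (relax z) s xs)
      min-node  : ∀ {z s ys} → done s z ≡ false → ys ↭ succ⁻ z →
                  Process (node (inj₁ z)) s (finishNode z (foldl (visit z) s ys))
      min-skip  : ∀ {z s} → done s z ≡ true →
                  Process (node (inj₁ z)) s s
      edge-new  : ∀ {z y s} → edgeDone s (z , y) ≡ false →
                  Process (edge z y) s (finishEdge z y (E⁻⁺ z y) s)
      edge-skip : ∀ {z y s} → edgeDone s (z , y) ≡ true →
                  Process (edge z y) s s

    infix 4 _⟶_ _⟶*_

    -- One iteration of the main loop.
    data _⟶_ (s s′ : State) : Set (c ⊔ ℓ₂) where
      extract : ∀ {o k Q′} →
                Q s ↭ (o , k) ∷ Q′ →
                All (λ occ → k ≤ proj₂ occ) Q′ →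
                Process o (record s { Q = Q′ }) s′ →
                s ⟶ s′

    _⟶*_ : State → State → Set (c ⊔ ℓ₂)
    _⟶*_ = Star _⟶_

    -- Whatever choices are made, the algorithm terminates, it never gets
    -- stuck while Q is non-empty, and the marking it returns satisfies P.
    record Returns {r} (P : Marking N → Set r) : Set (c ⊔ ℓ₂ ⊔ r) where
      field
        terminates : Acc (flip _⟶_) initial
        progress   : ∀ {s} → initial ⟶* s → Q s ≢ [] → ∃[ s′ ] s ⟶ s′
        result     : ∀ {s} → initial ⟶* s → Q s ≡ [] → P (M s)

  ----------------------------------------------------------------------
  -- Machine semantics

  record Store : Set c where
    field
      reg  : Name → ℕ
      nats : Name → ℕ → ℕ
      vals : Name → ℕ → Carrier
  open Store public

  ⟦_⟧ : Exp → Store → ℕ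
  ⟦ lit n ⟧   σ = n
  ⟦ var x ⟧   σ = reg σ x
  ⟦ a [ e ] ⟧ σ = nats σ a (⟦ e ⟧ σ)
  ⟦ inc e ⟧   σ = suc (⟦ e ⟧ σ)
  ⟦ dec e ⟧   σ = pred (⟦ e ⟧ σ)

  ⟦_⟧ᵛ : VExp → Store → Carrier
  ⟦ bottom ⟧ᵛ  σ = 0#
  ⟦ a [ e ] ⟧ᵛ σ = vals σ a (⟦ e ⟧ σ)

  ⟦_⟧ᵗ : Test → Store → Bool
  ⟦ e == f ⟧ᵗ σ = ⟦ e ⟧ σ ≡ᵇ ⟦ f ⟧ σ
  ⟦ e << f ⟧ᵗ σ = ⟦ e ⟧ σ <ᵇ ⟦ f ⟧ σ
  ⟦ v ≼ w ⟧ᵗ  σ = does (⟦ v ⟧ᵛ σ ≤? ⟦ w ⟧ᵛ σ)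
  ⟦ neg b ⟧ᵗ  σ = not (⟦ b ⟧ᵗ σ)
  ⟦ b && d ⟧ᵗ σ = ⟦ b ⟧ᵗ σ ∧ ⟦ d ⟧ᵗ σ

  setReg : Name → ℕ → Store → Store
  setReg x n σ = record σ { reg = update ℕ._≟_ x n (reg σ) }

  setNat : Name → ℕ → ℕ → Store → Store
  setNat a i n σ =
    record σ { nats = update ℕ._≟_ a (update ℕ._≟_ i n (nats σ a)) (nats σ) }

  setVal : Name → ℕ → Carrier → Store → Store
  setVal a i v σ =
    record σ { vals = update ℕ._≟_ a (update ℕ._≟_ i v (vals σ a)) (vals σ) }

  infix 4 ⟨_,_⟩⇓[_]_

  -- ⟨ C , σ ⟩⇓[ t ] σ′ : from store σ, C halts in store σ′ after t steps.
  -- Each elementary command and each test takes one step; the expressions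
  -- inside it have a size bounded by a constant of the program.
  data ⟨_,_⟩⇓[_]_ : Cmd → Store → ℕ → Store → Set c where
    skip : ∀ {σ} → ⟨ skip , σ ⟩⇓[ 1 ] σ
    assign : ∀ {σ x e} → ⟨ x := e , σ ⟩⇓[ 1 ] setReg x (⟦ e ⟧ σ) σ
    store : ∀ {σ a e f} →
      ⟨ a [ e ]:= f , σ ⟩⇓[ 1 ] setNat a (⟦ e ⟧ σ) (⟦ f ⟧ σ) σ
    storeᵛ : ∀ {σ a e v} →
      ⟨ a [ e ]:=ᵛ v , σ ⟩⇓[ 1 ] setVal a (⟦ e ⟧ σ) (⟦ v ⟧ᵛ σ) σ
    seq : ∀ {σ σ₁ σ₂ C D t u} →
      ⟨ C , σ ⟩⇓[ t ] σ₁ → ⟨ D , σ₁ ⟩⇓[ u ] σ₂ →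
      ⟨ C ⨾ D , σ ⟩⇓[ t ℕ.+ u ] σ₂
    if-true : ∀ {σ σ₁ b C D t} →
      ⟦ b ⟧ᵗ σ ≡ true → ⟨ C , σ ⟩⇓[ t ] σ₁ →
      ⟨ cond b C D , σ ⟩⇓[ suc t ] σ₁
    if-false : ∀ {σ σ₁ b C D t} →
      ⟦ b ⟧ᵗ σ ≡ false → ⟨ D , σ ⟩⇓[ t ] σ₁ →
      ⟨ cond b C D , σ ⟩⇓[ suc t ] σ₁
    while-false : ∀ {σ b C} →
      ⟦ b ⟧ᵗ σ ≡ false → ⟨ while b C , σ ⟩⇓[ 1 ] σ
    while-true : ∀ {σ σ₁ σ₂ b C t u} →
      ⟦ b ⟧ᵗ σ ≡ true → ⟨ C , σ ⟩⇓[ t ] σ₁ → ⟨ while b C , σ₁ ⟩⇓[ u ] σ₂ →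
      ⟨ while b C , σ ⟩⇓[ suc (t ℕ.+ u) ] σ₂

  ----------------------------------------------------------------------
  -- Implementing the algorithm on the machine

  record SortedInput (N : Net) : Set (c ⊔ ℓ₂) where
    open Net N
    field
      nodes       : List Vmin
      nodes-all   : nodes ↭ allFin p
      nodes-sort  : Sorted (map L nodes)
      up          : List (Vmin × Vmax)
      up-all      : up ↭ edges⁻⁺
      up-sort     : Sorted (map (λ (z , y) → E⁻⁺ z y) up)
      down        : List (Vmax × Vmin)
      down-all    : down ↭ edges⁺⁻

  nth : ∀ {a} {A : Set a} → A → List A → ℕ → A
  nth d []       _       = d
  nth d (x ∷ _)  zero    = x
  nth d (_ ∷ xs) (suc i) = nth d xs i

  -- Everything except the input is initially zero.
  load : ∀ {N} → SortedInput N → Store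
  load {N} I = record { reg = regs ; nats = natArrays ; vals = valArrays }
    where
    open Net N
    open SortedInput I
    regs : Name → ℕ
    regs #min  = p
    regs #max  = q
    regs #up   = length up
    regs #down = length down
    regs _     = 0
    natArrays : Name → ℕ → ℕ
    natArrays order   = nth 0 (map toℕ nodes)
    natArrays upSrc   = nth 0 (map (λ (z , y) → toℕ z) up)
    natArrays upTgt   = nth 0 (map (λ (z , y) → toℕ y) up)
    natArrays downSrc = nth 0 (map (λ (z , x) → toℕ z) down)
    natArrays downTgt = nth 0 (map (λ (z , x) → toℕ x) down)
    natArrays _       = λ _ → 0
    valArrays : Name → ℕ → Carrier
    valArrays limitᵛ = nth 0# (map L (allFin p))
    valArrays upᵛ    = nth 0# (map (λ (z , y) → E⁻⁺ z y) up)
    valArrays downᵛ  = nth 0# (map (λ (z , x) → E⁺⁻ z x) down)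
    valArrays _      = λ _ → 0#

  bit : Bool → ℕ
  bit false = 0
  bit true  = 1

  module _ {N : Net} (I : SortedInput N) where
    open Net N
    open SortedInput I
    open Algorithm N

    -- The store holds the marking, flags and counters of s.  How the
    -- priority queue is represented is left to the implementation.
    record Represents (σ : Store) (s : State) : Set c where
      field
        M-min      : ∀ x → vals σ Mminᵛ (toℕ x) ≡ M s (inj₁ x)
        M-max      : ∀ y → vals σ Mmaxᵛ (toℕ y) ≡ M s (inj₂ y)
        done≡      : ∀ x → nats σ doneᵃ (toℕ x) ≡ bit (done s x)
        edgeDone≡  : ∀ i → nats σ edgeDoneᵃ (toℕ i) ≡ bit (edgeDone s (lookup up i))
        count≡     : ∀ y → nats σ countᵃ (toℕ y) ≡ count s y

    -- Each iteration of the machine loop carries out one iteration of the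
    -- main loop of the algorithm, and the machine loop ends exactly when Q
    -- is empty.
    Tracks : ∀ {b C σ σ′ t} → State → ⟨ while b C , σ ⟩⇓[ t ] σ′ → Set (c ⊔ ℓ₂)
    Tracks {σ = σ} s (while-false _) = Represents σ s × Level.Lift ℓ₂ (Q s ≡ [])
    Tracks {σ = σ} s (while-true _ _ rest) =
      Represents σ s × Σ[ s′ ∈ State ] (s ⟶ s′ × Tracks s′ rest)

    -- The run is a run of Algorithm 1 on the net.
    Implements : ∀ {P t σ} → ⟨ Program.command P , load I ⟩⇓[ t ] σ → Set (c ⊔ ℓ₂)
    Implements (seq _ loop) = Tracks initial loop

{-# OPTIONS --safe #-}
module Submission where

-- Keys leave the queue in increasing order.  When k is extracted, max-nodes
-- and finished min-nodes have values at most k, while everything unfinished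
-- is still queued with a key at least k.  Hence max-nodes are only ever raised
-- to k and min-nodes only lowered to k.  Min-nodes, and max-nodes with no open
-- incoming edge, stay above every correct marking, and once the queue is empty
-- the marking is itself correct.  A potential that charges
-- each max-node and each unfinished min-node its out-degree drops by at least
-- the work of every iteration: this gives termination and the linear bound.
-- A node inserted while k is processed has key k up to equivalence, so the
-- machine needs no priority queue beyond stacks for the inserted nodes and the
-- two sorted input lists.

open import Defs
open import Data.Nat.Base using (ℕ; _+_; _*_; _≤_)
open import Data.Product.Base using (_×_; Σ-syntax; ∃-syntax)

open import Data.Bool.Base using (Bool; true; false; not; _∧_; if_then_else_)
open import Data.Bool.Properties using (∧-zeroʳ)
open import Data.Fin.Base as Fin using (Fin; toℕ)
import Data.Fin.Properties as Fin
open import Data.List.Base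
  using (List; []; _∷_; _++_; map; filter; filterᵇ; foldl; length; lookup; null; allFin; cartesianProduct)
import Data.List.Properties as List
open import Data.List.Membership.Propositional using (_∈_)
open import Data.List.Membership.Propositional.Properties
  using (∈-map⁺; ∈-map⁻; ∈-++⁺ˡ; ∈-++⁺ʳ; ∈-++⁻; ∈-filter⁺; ∈-filter⁻; ∈-allFin; ∈-cartesianProduct⁺)
open import Data.List.Relation.Binary.Permutation.Propositional using (_↭_; ↭-refl; ↭-sym; ↭-trans; prep; ↭⇒↭ₛ)
import Data.List.Relation.Binary.Permutation.Propositional.Properties as Perm
import Data.List.Relation.Binary.Permutation.Setoid.Properties as SetoidPerm
open import Data.List.Relation.Unary.All as All using (All; []; _∷_)
import Data.List.Relation.Unary.All.Properties as All
open import Data.List.Relation.Unary.AllPairs as AllPairs using (AllPairs; []; _∷_)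
import Data.List.Relation.Unary.AllPairs.Properties as AllPairs
open import Data.List.Relation.Unary.Any using (here; there)
open import Data.List.Relation.Unary.Sorted.TotalOrder.Properties using (Sorted⇒AllPairs)
open import Data.List.Relation.Unary.Unique.Propositional using (Unique)
import Data.List.Relation.Unary.Unique.Propositional.Properties as Unique
open import Data.Nat.Base as ℕ using (zero; suc; pred; _<_; _≡ᵇ_; _<ᵇ_; z≤n; s≤s; z<s)
open import Data.Nat.ListAction using (sum)
open import Data.Nat.ListAction.Properties using (sum-↭; sum-++)
import Data.Nat.Properties as ℕ
import Data.Nat.Solver
open Data.Nat.Solver.+-*-Solver using (solve; con; _:+_; _:*_) renaming (_:=_ to _:≡_)
open import Data.Product.Base as Product using (∃; _,_; proj₁; proj₂)
open import Data.Sum.Base as Sum using (_⊎_; inj₁; inj₂)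
open import Function.Base using (flip; _∘_; id; const; case_of_)
open import Induction.WellFounded using (Acc; acc)
open import Level as Level using (Level; _⊔_; lift)
open import Relation.Binary.Construct.Closure.ReflexiveTransitive using (ε; _◅_)
open import Relation.Binary.Definitions using (DecidableEquality)
open import Relation.Binary.PropositionalEquality
  using (_≡_; _≢_; refl; sym; trans; cong; cong₂; subst; setoid; module ≡-Reasoning)
open import Relation.Nullary.Decidable using (does; yes; no; Dec; dec-true)
open import Relation.Nullary.Negation using (¬_; contradiction)

-- Greatness and correctness come from two different kinds of bound. Being above every correct
-- marking is kept by each single assignment, because assignments happen at the current level, which
-- bounds the max-nodes from above and whatever is still open from below. Correctness at max-nodes
-- comes from a witness: every mark above `0#` remembers one incoming edge that supports it. Later
-- lowering of the source does no harm, since sources are lowered to the level and no max-node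
-- exceeds the level. The machine meets another obstacle: expanding a min-node needs its outgoing
-- edges grouped by source, whereas the input lists them by value. Linked lists are therefore
-- threaded through the sorted edge list itself. An edge is named by its position there in both
-- traversals, and one flag per position serves both.

private
  variable
    a b r : Level
    A B : Set a

-- Function updates, counting of lowered flags, and sums.

module _ {A : Set a} {B : Set b} (_≟_ : DecidableEquality A) where

  -- The motive `P` allows a case split at the updated point without exposing the decision procedure
  -- in the goal. State transformers below get eliminators of the same shape.
  update-elim : ∀ x {v} (f : A → B) y (P : B → Set r) →
                (y ≡ x → P v) → (y ≢ x → P (f y)) → P (update _≟_ x v f y)
  update-elim x f y P same other with y ≟ x
  ... | yes y≡x = same y≡x
  ... | no  y≢x = other y≢x

  update-same : ∀ x {v} (f : A → B) → update _≟_ x v f x ≡ v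
  update-same x f = update-elim x f x (_≡ _) (λ _ → refl) (λ x≢x → contradiction refl x≢x)

  update-other : ∀ x {v} (f : A → B) y → y ≢ x → update _≟_ x v f y ≡ f y
  update-other x f y y≢x = update-elim x f y (_≡ f y) (λ y≡x → contradiction y≡x y≢x) (λ _ → refl)

#false : (A → Bool) → List A → ℕ
#false f xs = length (filterᵇ (not ∘ f) xs)

#false-cong : ∀ {f g : A → Bool} {xs} → All (λ x → f x ≡ g x) xs → #false f xs ≡ #false g xs
#false-cong [] = refl
#false-cong {f = f} {g} {x ∷ _} (fx≡gx ∷ eqs) with f x | g x | fx≡gx
... | true  | _ | refl = #false-cong eqs
... | false | _ | refl = cong suc (#false-cong eqs)

#false-zero : ∀ {f : A → Bool} {xs x} → #false f xs ≡ 0 → x ∈ xs → f x ≡ true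
#false-zero {f = f} {x ∷ _} eq x∈ with f x in fx
#false-zero eq (here refl) | true  = fx
#false-zero eq (there x∈)  | true  = #false-zero eq x∈

#false-all : ∀ {f : A → Bool} xs → (∀ x → f x ≡ false) → #false f xs ≡ length xs
#false-all []       all = refl
#false-all (x ∷ xs) all rewrite all x = cong suc (#false-all xs all)

#false-none : ∀ {f : A → Bool} {xs} → All (λ x → f x ≡ true) xs → #false f xs ≡ 0
#false-none []         = refl
#false-none (fx ∷ fxs) rewrite fx = #false-none fxs

-- Absence of duplicates makes raising one flag lower the count by exactly one. The result is
-- phrased with `pred` because that is how the algorithm updates its counters.
#false-remove : ∀ {f g : A → Bool} {xs x} → Unique xs → x ∈ xs → f x ≡ false → g x ≡ true →
                (∀ {y} → y ≢ x → g y ≡ f y) → #false g xs ≡ pred (#false f xs)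
#false-remove (x∉xs ∷ _) (here refl) fx gx eq rewrite fx | gx =
  #false-cong (All.map (λ x≢y → eq (x≢y ∘ sym)) x∉xs)
#false-remove {f = f} {g} {y ∷ xs} (y∉xs ∷ xs!) (there x∈) fx gx eq
  rewrite eq (All.lookup y∉xs x∈) with f y
... | true  = #false-remove xs! x∈ fx gx eq
-- The tail still contains `x`, whose flag is down under `f`, so its count is nonzero and `suc`
-- cancels `pred`.
... | false = trans (cong suc (#false-remove xs! x∈ fx gx eq)) (suc-pred x∈)
  where
  suc-pred : ∀ {xs} → _ ∈ xs → suc (pred (#false f xs)) ≡ #false f xs
  suc-pred {xs} x∈ with #false f xs in eq₀
  ... | suc _ = refl
  ... | zero with () ← trans (sym fx) (#false-zero eq₀ x∈)

sum-map-mono : ∀ {f g : A → ℕ} xs → (∀ x → f x ≤ g x) → sum (map f xs) ≤ sum (map g xs)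
sum-map-mono []       f≤g = z≤n
sum-map-mono (x ∷ xs) f≤g = ℕ.+-mono-≤ (f≤g x) (sum-map-mono xs f≤g)

-- This is how a potential drops: one entry releases `d` and no other entry rises.
sum-map-decrease : ∀ {f g : A → ℕ} {d xs x} → (∀ x → f x ≤ g x) → x ∈ xs → d + f x ≤ g x →
                   d + sum (map f xs) ≤ sum (map g xs)
sum-map-decrease {f = f} {d = d} {x ∷ xs} f≤g (here refl) le = begin
  d + (f x + sum (map f xs)) ≡⟨ ℕ.+-assoc d (f x) _ ⟨
  d + f x + sum (map f xs)   ≤⟨ ℕ.+-mono-≤ le (sum-map-mono xs f≤g) ⟩
  _                          ∎
  where open ℕ.≤-Reasoning
sum-map-decrease {f = f} {g} {d} {y ∷ xs} f≤g (there x∈) le = begin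
  d + (f y + sum (map f xs)) ≡⟨ ℕ.+-assoc d (f y) _ ⟨
  d + f y + sum (map f xs)   ≡⟨ cong (_+ sum (map f xs)) (ℕ.+-comm d (f y)) ⟩
  f y + d + sum (map f xs)   ≡⟨ ℕ.+-assoc (f y) d _ ⟩
  f y + (d + sum (map f xs)) ≤⟨ ℕ.+-mono-≤ (f≤g y) (sum-map-decrease f≤g x∈ le) ⟩
  _                          ∎
  where open ℕ.≤-Reasoning

-- Each round costs at most `k` for the body and one for the test; the remaining unit is the last,
-- failing test.
loop-bound : ∀ k m {t u} → t ≤ k → u ≤ suc (suc k * m) → suc (t + u) ≤ suc (suc k * suc m)
loop-bound k m {t} {u} t≤k u≤ = s≤s (begin
  t + u                 ≤⟨ ℕ.+-mono-≤ t≤k u≤ ⟩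
  k + suc (suc k * m)   ≡⟨ ℕ.+-suc k _ ⟩
  suc k + suc k * m     ≡⟨ ℕ.*-suc (suc k) m ⟨
  suc k * suc m         ∎)
  where open ℕ.≤-Reasoning

-- Gödel structure

module Gödel {c ℓ₁ ℓ₂} (chain : BoundedChain c ℓ₁ ℓ₂) where

  open Minimax chain public
    renaming (_≤_ to _⊑_; _<_ to _⊏_; _≤?_ to _⊑?_; _<?_ to _⊏?_; refl to ⊑-refl; trans to ⊑-trans; antisym to ⊑-antisym)
    hiding (_≟_)
  open import Relation.Binary.Properties.DecTotalOrder (BoundedChain.decTotalOrder chain) public
    using (≮⇒≥; ≰⇒>; ≰⇒≥; <⇒≱)
  import Algebra.Construct.NaturalChoice.Min totalOrder as Min
  import Algebra.Construct.NaturalChoice.Max totalOrder as Max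

  ⊑≡-trans : ∀ {x y z} → x ⊑ y → y ≡ z → x ⊑ z
  ⊑≡-trans le refl = le

  ≡⊏-trans : ∀ {x y z} → x ≡ y → y ⊏ z → x ⊏ z
  ≡⊏-trans refl lt = lt

  ⊗-lowerˡ : ∀ {x y} → x ⊗ y ⊑ x
  ⊗-lowerˡ = Min.x⊓y≤x _ _

  ⊗-lowerʳ : ∀ {x y} → x ⊗ y ⊑ y
  ⊗-lowerʳ = Min.x⊓y≤y _ _

  ⊗-greatest : ∀ {x y z} → x ⊑ y → x ⊑ z → x ⊑ y ⊗ z
  ⊗-greatest = Min.⊓-glb

  ⋀-greatest : ∀ {x k} {f : Fin k → Carrier} → (∀ i → x ⊑ f i) → x ⊑ ⋀ f
  ⋀-greatest {k = zero}  le = maximum _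
  ⋀-greatest {k = suc k} le = Min.⊓-glb (le Fin.zero) (⋀-greatest (le ∘ Fin.suc))

  ⋀-lower : ∀ {k} (f : Fin k → Carrier) i → ⋀ f ⊑ f i
  ⋀-lower f Fin.zero    = Min.x⊓y≤x _ _
  ⋀-lower f (Fin.suc i) = ⊑-trans (Min.x⊓y≤y _ _) (⋀-lower (f ∘ Fin.suc) i)

  ⋁-least : ∀ {x k} {f : Fin k → Carrier} → (∀ i → f i ⊑ x) → ⋁ f ⊑ x
  ⋁-least {k = zero}  le = minimum _
  ⋁-least {k = suc k} le = Max.⊔-lub (le Fin.zero) (⋁-least (le ∘ Fin.suc))

  ⋁-upper : ∀ {k} (f : Fin k → Carrier) i → f i ⊑ ⋁ f
  ⋁-upper f Fin.zero    = Max.x≤x⊔y _ _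
  ⋁-upper f (Fin.suc i) = ⊑-trans (⋁-upper (f ∘ Fin.suc) i) (Max.x≤y⊔x _ _)

  ⇒-strict : ∀ {x y} → y ⊏ x → (x ⇒ y) ≡ y
  ⇒-strict {x} {y} y⊏x = cong (if_then y else 1#) (dec-true (y ⊏? x) y⊏x)

  ⇒-intro : ∀ {w x y} → (y ⊏ x → w ⊑ y) → w ⊑ (x ⇒ y)
  ⇒-intro {x = x} {y} le with y ⊏? x
  ... | yes y⊏x = le y⊏x
  ... | no  _   = maximum _

  -- The machine can only test the weak order, so the strict comparison of the algorithm is run as
  -- the negated converse.
  does-⊏? : ∀ x y → does (x ⊏? y) ≡ not (does (y ⊑? x))
  does-⊏? x y with x ⊏? y | y ⊑? x
  ... | yes _   | no  _   = refl
  ... | no  _   | yes _   = refl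
  ... | yes x⊏y | yes y⊑x = contradiction y⊑x (<⇒≱ x⊏y)
  ... | no  x⊏̸y | no  y⋢x = contradiction (≰⇒> y⋢x) x⊏̸y

-- Loop invariant

module Invariant {c ℓ₁ ℓ₂} (chain : BoundedChain c ℓ₁ ℓ₂) (N : Minimax.Net chain) where

  open Gödel chain
  open Net N public
  open Algorithm N public

  Occurrence : Set c
  Occurrence = Obj × Carrier

  -- A copy of the state local to `finishEdge`, named so that proofs can speak of the moment before
  -- the conditional insertion.
  settle : Vmin → Vmax → Carrier → State → State
  settle z y a s = record (mark (inj₂ y) a s)
    { edgeDone = update _≟E_ (z , y) true (edgeDone s)
    ; count    = update Fin._≟_ y (pred (count s y)) (count s)
    }

  finishEdge-elim : ∀ z y a s (P : State → Set r) → let s′ = settle z y a s in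
                    (count s′ y ≡ 0 → P (insert (inj₂ y) s′)) → (count s′ y ≢ 0 → P s′) →
                    P (finishEdge z y a s)
  finishEdge-elim z y a s P ins stay with count (settle z y a s) y
  ... | zero  = ins refl
  ... | suc _ = stay λ ()

  key : State → Obj → Carrier
  key s (node v)   = M s v
  key s (edge z y) = E⁻⁺ z y

  -- No queued occurrence is required on behalf of a finished object. A max-node with open incoming
  -- edges counts as finished, because it is queued only when its counter reaches zero; from then on
  -- the clause asks for exactly what the min-condition demands of its outgoing edges.
  Finished : State → Obj → Set (ℓ₁ ⊔ ℓ₂)
  Finished s (node (inj₁ x)) = Level.Lift (ℓ₁ ⊔ ℓ₂) (done s x ≡ true)
  Finished s (node (inj₂ y)) =
    count s y ≡ 0 → ∀ x → M s (inj₂ y) ⊏ E⁺⁻ y x → M s (inj₁ x) ⊑ M s (inj₂ y)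
  Finished s (edge z y)      = 0# ⊏ E⁻⁺ z y → edgeDone s (z , y) ≡ true

  -- Occurrences of a min-node can be stale, since its mark may have been lowered after the
  -- insertion; hence an inequality. A queued max-node has no open incoming edge left, so its mark
  -- is final and equals the key.
  Valid : State → Occurrence → Set (c ⊔ ℓ₁ ⊔ ℓ₂)
  Valid s (node (inj₁ x) , k) = Level.Lift (c ⊔ ℓ₁) (M s (inj₁ x) ⊑ k)
  Valid s (node (inj₂ y) , k) = Level.Lift (ℓ₁ ⊔ ℓ₂) (count s y ≡ 0 × M s (inj₂ y) ≡ k)
  Valid s (edge z y , k)      = 0# ⊏ E⁻⁺ z y × E⁻⁺ z y ≡ k

  -- cur lists the occurrences that have been extracted from the queue but
  -- whose processing is not complete; ℓ is the last extracted key.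
  record Inv (cur : List Occurrence) (ℓ : Carrier) (s : State) : Set (c ⊔ ℓ₁ ⊔ ℓ₂) where
    field
      keys    : ∀ {o} → o ∈ Q s → ℓ ⊑ proj₂ o
      level   : ∀ {o} → o ∈ cur → ℓ ⊑ proj₂ o
      valid   : ∀ o → o ∈ Q s → Valid s o
      pending : ∀ o → Finished s o ⊎ (o , key s o) ∈ Q s ++ cur
      max≤    : ∀ y → M s (inj₂ y) ⊑ ℓ
      done≤   : ∀ x → done s x ≡ true → M s (inj₁ x) ⊑ ℓ
      closed  : ∀ {z} → done s z ≡ true → ∀ {y} → 0# ⊏ E⁻⁺ z y → edgeDone s (z , y) ≡ true
      count≡  : ∀ y → count s y ≡ #false (λ z → edgeDone s (z , y)) (pred⁺ y)
      limit   : ∀ x → M s (inj₁ x) ⊑ L x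
      support : ∀ y → M s (inj₂ y) ⊑ 0# ⊎
                      (∃[ z ] M s (inj₂ y) ⊑ E⁻⁺ z y × M s (inj₂ y) ⊑ M s (inj₁ z))
      above⁻  : ∀ {M′} → Correct N M′ → ∀ x → M′ (inj₁ x) ⊑ M s (inj₁ x)
      above⁺  : ∀ {M′} → Correct N M′ → ∀ {z y} → edgeDone s (z , y) ≡ true →
                E⁻⁺ z y ⊗ M′ (inj₁ z) ⊑ M s (inj₂ y)

    -- An unfinished object is present in `Q` or `cur` under its current key, not merely under a
    -- stale one, so the level bounds that key from below.
    pending≥ : ∀ {o} → ¬ Finished s o → ℓ ⊑ key s o
    pending≥ {o} unfinished with pending o
    ... | inj₁ fin = contradiction fin unfinished
    ... | inj₂ o∈ with ∈-++⁻ (Q s) o∈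
    ...   | inj₁ o∈Q   = keys o∈Q
    ...   | inj₂ o∈cur = level o∈cur

    undone≥ : ∀ {x} → done s x ≡ false → ℓ ⊑ M s (inj₁ x)
    undone≥ {x} undone = pending≥ {node (inj₁ x)} λ { (lift d) → case trans (sym undone) d of λ () }

  pred⁺-member : ∀ {z y} → 0# ⊏ E⁻⁺ z y → z ∈ pred⁺ y
  pred⁺-member pos = ∈-filter⁺ (λ z → 0# ⊏? E⁻⁺ z _) (∈-allFin _) pos

  pred⁺-unique : ∀ y → Unique (pred⁺ y)
  pred⁺-unique y = Unique.filter⁺ (λ z → 0# ⊏? E⁻⁺ z y) (Unique.allFin⁺ p)

  zero⊗ : ∀ {z y u} → ¬ 0# ⊏ E⁻⁺ z y → E⁻⁺ z y ⊗ u ⊑ 0#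
  zero⊗ ¬pos = ⊑-trans ⊗-lowerˡ (≮⇒≥ ¬pos)

  module _ {cur : List Occurrence} {ℓ : Carrier} {s : State} (inv : Inv cur ℓ s) where
    open Inv inv

    all-edges-done : ∀ {z y} → count s y ≡ 0 → 0# ⊏ E⁻⁺ z y → edgeDone s (z , y) ≡ true
    all-edges-done eq pos = #false-zero (trans (sym (count≡ _)) eq) (pred⁺-member pos)

    count-pos : ∀ {z y} → 0# ⊏ E⁻⁺ z y → edgeDone s (z , y) ≡ false → count s y ≢ 0
    count-pos pos undone eq = case trans (sym undone) (all-edges-done eq pos) of λ ()

    -- A zero counter means that every positive incoming edge is settled, so `above⁺` bounds each
    -- term of the supremum; the remaining terms are at most `0#`.
    above-max : ∀ {M′} → Correct N M′ → ∀ {y} → count s y ≡ 0 → M′ (inj₂ y) ⊑ M s (inj₂ y)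
    above-max {M′} cor {y} eq = ⊑-trans (Correct.max cor y) (⋁-least below)
      where
      below : ∀ z → E⁻⁺ z y ⊗ M′ (inj₁ z) ⊑ M s (inj₂ y)
      below z with 0# ⊏? E⁻⁺ z y
      ... | yes pos  = above⁺ cor (all-edges-done eq pos)
      ... | no  ¬pos = ⊑-trans (zero⊗ ¬pos) (minimum _)

    -- An entry can leave `cur` in two ways: its object is finished, as here, or it goes back to the
    -- queue, as in `insert-inv`.
    drop-inv : ∀ {o cur′} → cur ≡ o ∷ cur′ → Finished s (proj₁ o) → Inv cur′ ℓ s
    drop-inv {o} {cur′} refl fin = record
      { Inv inv
      ; level   = level ∘ there
      ; pending = pending′
      }
      where
      pending′ : ∀ o′ → Finished s o′ ⊎ (o′ , key s o′) ∈ Q s ++ cur′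
      pending′ o′ with pending o′
      ... | inj₁ fin′ = inj₁ fin′
      ... | inj₂ o∈ with Perm.∈-resp-↭ (Perm.shift o (Q s) cur′) o∈
      ...   | here refl = inj₁ fin
      ...   | there o∈′ = inj₂ o∈′

    insert-inv : ∀ {v cur′} → cur ≡ (node v , M s v) ∷ cur′ → Valid s (node v , M s v) →
                 Inv cur′ ℓ (insert v s)
    insert-inv {v} {cur′} refl val = record
      { Inv inv
      ; keys    = λ { (here refl) → level (here refl) ; (there o∈) → keys o∈ }
      ; level   = level ∘ there
      ; valid   = λ where
          (node (inj₁ _) , _) (here refl) → val
          (node (inj₂ _) , _) (here refl) → val
          (node (inj₁ _) , _) (there o∈) → valid _ o∈
          (node (inj₂ _) , _) (there o∈) → valid _ o∈
          (edge _ _ , _)      (there o∈) → valid _ o∈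
      ; pending = pending′
      }
      where
      pending′ : ∀ o → Finished (insert v s) o ⊎ (o , key (insert v s) o) ∈ Q (insert v s) ++ cur′
      pending′ o with pending o
      pending′ (node (inj₁ _)) | inj₁ fin = inj₁ fin
      pending′ (node (inj₂ _)) | inj₁ fin = inj₁ fin
      pending′ (edge _ _)      | inj₁ fin = inj₁ fin
      pending′ (node _)        | inj₂ o∈  = inj₂ (Perm.∈-resp-↭ (Perm.shift _ (Q s) cur′) o∈)
      pending′ (edge _ _)      | inj₂ o∈  = inj₂ (Perm.∈-resp-↭ (Perm.shift _ (Q s) cur′) o∈)

  later : ∀ {o o′ : Occurrence} Q {cur} → o ∈ Q ++ cur → o ∈ Q ++ o′ ∷ cur
  later Q o∈ = Perm.∈-resp-↭ (↭-sym (Perm.shift _ Q _)) (there o∈)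

  now : ∀ {o : Occurrence} Q {cur} → o ∈ Q ++ o ∷ cur
  now Q = ∈-++⁺ʳ Q (here refl)

  -- The level may jump to `k`: old upper bounds survive because `ℓ ⊑ k`, the remaining keys are at
  -- least `k` by minimality, and `pending` still finds the extracted occurrence in `cur`.
  extract-inv : ∀ {ℓ s o k Q′} → Inv [] ℓ s → Q s ↭ (o , k) ∷ Q′ →
                All (λ occ → k ⊑ proj₂ occ) Q′ → Inv ((o , k) ∷ []) k (record s { Q = Q′ })
  extract-inv {ℓ} {s} {o} {k} {Q′} inv perm least = record
    { Inv inv
    ; keys    = All.lookup least
    ; level   = λ { (here refl) → ⊑-refl }
    ; valid   = λ where
        (node (inj₁ _) , _) o∈ → valid _ (queue o∈)
        (node (inj₂ _) , _) o∈ → valid _ (queue o∈)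
        (edge _ _ , _)      o∈ → valid _ (queue o∈)
    ; pending = pending′
    ; max≤    = λ y → ⊑-trans (max≤ y) ℓ⊑k
    ; done≤   = λ x d → ⊑-trans (done≤ x d) ℓ⊑k
    }
    where
    open Inv inv
    queue : ∀ {o′} → o′ ∈ Q′ → o′ ∈ Q s
    queue o∈ = Perm.∈-resp-↭ (↭-sym perm) (there o∈)
    ℓ⊑k : ℓ ⊑ k
    ℓ⊑k = keys (Perm.∈-resp-↭ (↭-sym perm) (here refl))
    moved : ∀ {o′} → o′ ∈ Q s ++ [] → o′ ∈ Q′ ++ (o , k) ∷ []
    moved o∈ = Perm.∈-resp-↭ (↭-trans perm (↭-sym (Perm.++-comm Q′ _)))
                 (subst (_ ∈_) (List.++-identityʳ (Q s)) o∈)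
    pending′ : ∀ o′ → Finished (record s { Q = Q′ }) o′ ⊎
                      (o′ , key (record s { Q = Q′ }) o′) ∈ Q′ ++ (o , k) ∷ []
    pending′ (node (inj₁ x)) = Sum.map id moved (pending (node (inj₁ x)))
    pending′ (node (inj₂ y)) = Sum.map id moved (pending (node (inj₂ y)))
    pending′ (edge z y)      = Sum.map id moved (pending (edge z y))

  -- The value `a` is equivalent to the level, so overwriting the mark of `y` can only raise it. The
  -- bounds by the edge and by its source make this edge the new witness in `support`; the last
  -- premise is what `above⁺` needs for it. The node enters `cur`, since it may now have to be
  -- queued.
  settle-inv : ∀ {cur ℓ s z y a} → Inv cur ℓ s → 0# ⊏ E⁻⁺ z y → edgeDone s (z , y) ≡ false →
               ℓ ⊑ a → a ⊑ ℓ → a ⊑ E⁻⁺ z y → a ⊑ M s (inj₁ z) →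
               (∀ {M′} → Correct N M′ → E⁻⁺ z y ⊗ M′ (inj₁ z) ⊑ a) →
               Inv ((node (inj₂ y) , a) ∷ cur) ℓ (settle z y a s)
  settle-inv {cur} {ℓ} {s} {z} {y} {a} inv pos undone ℓ⊑a a⊑ℓ a⊑E a⊑M bound = record
    { keys    = keys
    ; level   = λ { (here refl) → ℓ⊑a ; (there o∈) → level o∈ }
    ; valid   = valid′
    ; pending = pending′
    ; max≤    = λ y′ → M-elim (_⊑ ℓ) (λ _ → a⊑ℓ) (λ _ → max≤ y′)
    ; done≤   = done≤
    ; closed  = λ d pos′ → edge-mono (closed d pos′)
    ; count≡  = count′
    ; limit   = limit
    ; support = λ y′ → M-elim (λ m → m ⊑ 0# ⊎ (∃[ z′ ] m ⊑ E⁻⁺ z′ y′ × m ⊑ M s (inj₁ z′)))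
                  (λ { refl → inj₂ (z , a⊑E , a⊑M) }) (λ _ → support y′)
    ; above⁻  = above⁻
    ; above⁺  = above′
    }
    where
    open Inv inv
    s′ : State
    s′ = settle z y a s

    M-elim : ∀ {y′} (P : Carrier → Set r) → (y′ ≡ y → P a) → (y′ ≢ y → P (M s (inj₂ y′))) →
             P (M s′ (inj₂ y′))
    M-elim {y′ = y′} P same other = update-elim _≟V_ (inj₂ y) (M s) (inj₂ y′) P (λ { refl → same refl }) (λ neq → other λ { refl → neq refl })
    M-y : M s′ (inj₂ y) ≡ a
    M-y = update-same _≟V_ (inj₂ y) (M s)

    edge-mono : ∀ {e} → edgeDone s e ≡ true → edgeDone s′ e ≡ true
    edge-mono {e} d = update-elim _≟E_ (z , y) (edgeDone s) e (_≡ true) (λ _ → refl) (λ _ → d)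

    valid′ : ∀ o → o ∈ Q s → Valid s′ o
    valid′ (node (inj₁ x) , k)  o∈ = valid _ o∈
    valid′ (edge z′ y′ , k)     o∈ = valid _ o∈
    valid′ (node (inj₂ y′) , k) o∈ with lift (cnt , M≡k) ← valid _ o∈ | y′ Fin.≟ y
    -- The edge being settled was open, so the counter of `y` was nonzero and `y` had no occurrence
    -- whose key could become outdated.
    ... | yes refl = contradiction cnt (count-pos inv pos undone)
    ... | no  _    = lift (cnt , M≡k)

    pending′ : ∀ o → Finished s′ o ⊎ (o , key s′ o) ∈ Q s ++ (node (inj₂ y) , a) ∷ cur
    pending′ (node (inj₁ x)) = Sum.map id (later (Q s)) (pending (node (inj₁ x)))
    pending′ (edge z′ y′) = Sum.map (edge-mono ∘_) (later (Q s)) (pending (edge z′ y′))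
    pending′ (node (inj₂ y′)) with y′ Fin.≟ y
    ... | yes refl = inj₂ (now (Q s))
    ... | no  _    = Sum.map id (later (Q s)) (pending (node (inj₂ y′)))

    count′ : ∀ y′ → count s′ y′ ≡ #false (λ z′ → edgeDone s′ (z′ , y′)) (pred⁺ y′)
    count′ y′ = update-elim Fin._≟_ y (count s) y′ (_≡ #false (λ z′ → edgeDone s′ (z′ , y′)) (pred⁺ y′))
      (λ { refl → trans (cong pred (count≡ y))
             (sym (#false-remove (pred⁺-unique y) (pred⁺-member pos) undone
                     (update-same _≟E_ (z , y) (edgeDone s))
                     (λ neq → update-other _≟E_ (z , y) (edgeDone s) _ λ { refl → neq refl }))) })
      (λ neq → trans (count≡ y′) (#false-cong (All.universal
        (λ z′ → sym (update-other _≟E_ (z , y) (edgeDone s) (z′ , y′) λ { refl → neq refl })) (pred⁺ y′))))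

    above′ : ∀ {M′} → Correct N M′ → ∀ {z′ y′} → edgeDone s′ (z′ , y′) ≡ true →
             E⁻⁺ z′ y′ ⊗ M′ (inj₁ z′) ⊑ M s′ (inj₂ y′)
    above′ {M′} cor {z′} {y′} d with (z′ , y′) ≟E (z , y)
    ... | yes refl = subst (_ ⊑_) (sym M-y) (bound cor)
    -- For an edge settled earlier into the same `y`, the contribution is below the old mark, which
    -- is below the level and hence below `a`.
    ... | no  neq  = M-elim (_ ⊑_)
      (λ { refl → ⊑-trans (above⁺ cor d) (⊑-trans (max≤ y) ℓ⊑a) }) (λ _ → above⁺ cor d)

  finishEdge-inv : ∀ {cur ℓ s z y a} → Inv cur ℓ s → 0# ⊏ E⁻⁺ z y → edgeDone s (z , y) ≡ false →
                   ℓ ⊑ a → a ⊑ ℓ → a ⊑ E⁻⁺ z y → a ⊑ M s (inj₁ z) →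
                   (∀ {M′} → Correct N M′ → E⁻⁺ z y ⊗ M′ (inj₁ z) ⊑ a) →
                   Inv cur ℓ (finishEdge z y a s)
  finishEdge-inv {cur} {ℓ} {s} {z} {y} {a} inv pos undone ℓ⊑a a⊑ℓ a⊑E a⊑M bound =
    finishEdge-elim z y a s (Inv cur ℓ)
      (λ eq → insert-inv settled (cong (λ m → (_ , m) ∷ cur) (sym (update-same _≟V_ (inj₂ y) (M s))))
                (lift (eq , refl)))
      -- With a nonzero counter the max-node is finished vacuously.
      (λ neq → drop-inv settled refl (λ eq → contradiction eq neq))
    where
    settled : Inv ((node (inj₂ y) , a) ∷ cur) ℓ (settle z y a s)
    settled = settle-inv inv pos undone ℓ⊑a a⊑ℓ a⊑E a⊑M bound

-- Effect of one iteration on the invariant and on the potential.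

module Step {c ℓ₁ ℓ₂} (chain : BoundedChain c ℓ₁ ℓ₂) (N : Minimax.Net chain) where
  open Gödel chain
  open Invariant chain N public

  lower : Vmax → State → Vmin → State
  lower z s x = insert (inj₁ x) (mark (inj₁ x) (M s (inj₂ z)) s)

  relax-elim : ∀ z s x (P : State → Set r) →
               (done s x ≡ false → M s (inj₂ z) ⊏ E⁺⁻ z x → P (lower z s x)) →
               ((M s (inj₂ z) ⊏ E⁺⁻ z x → done s x ≡ true) → P s) → P (relax z s x)
  relax-elim z s x P low stay with done s x | M s (inj₂ z) ⊏? E⁺⁻ z x
  ... | true  | _        = stay λ _ → refl
  ... | false | yes lt   = low refl lt
  ... | false | no  ¬lt  = stay λ lt → contradiction lt ¬lt

  visit-elim : ∀ z s y (P : State → Set r) →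
               (edgeDone s (z , y) ≡ false → P (finishEdge z y (M s (inj₁ z)) s)) →
               (edgeDone s (z , y) ≡ true → P s) → P (visit z s y)
  visit-elim z s y P fresh stay with edgeDone s (z , y)
  ... | true  = stay refl
  ... | false = fresh refl

  -- A max-node pays one unit for its extraction, its out-degree for the scan, and its out-degree
  -- again for the min-node occurrences, of weight one each, that the scan may insert.
  weight : Obj → ℕ
  weight (node (inj₁ _)) = 1
  weight (node (inj₂ y)) = suc (length (succ⁺ y) + length (succ⁺ y))
  weight (edge _ _)      = 1

  reserve : (Vmax → ℕ) → Vmax → ℕ
  reserve cnt y = if cnt y ≡ᵇ 0 then 0 else weight (node (inj₂ y))

  owed : (Vmin → Bool) → Vmin → ℕ
  owed d z = if d z then 0 else length (succ⁻ z)

  -- Queued occurrences, max-nodes still to be queued and min-nodes still to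
  -- be expanded prepay the work they will cause.
  Φ : State → ℕ
  Φ s = sum (map (weight ∘ proj₁) (Q s)) +
        (sum (map (reserve (count s)) (allFin q)) + sum (map (owed (done s)) (allFin p)))

  Φ-relax : ∀ z s x → Φ (relax z s x) ≤ suc (Φ s)
  Φ-relax z s x = relax-elim z s x (λ s′ → Φ s′ ≤ suc (Φ s)) (λ _ _ → ℕ.≤-refl) (λ _ → ℕ.n≤1+n _)

  -- The weight of a newly queued max-node is its own reserve, released at the moment its counter
  -- reaches zero. The counter has to be nonzero beforehand, or the reserve would already be spent.
  Φ-finishEdge : ∀ {z y a} s → count s y ≢ 0 → Φ (finishEdge z y a s) ≤ Φ s
  Φ-finishEdge {z} {y} {a} s cnt≢0 = finishEdge-elim z y a s (λ s″ → Φ s″ ≤ Φ s)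
    (λ eq → begin
      (w + q₀) + (sum (map (reserve (count s′)) (allFin q)) + d₀) ≡⟨ cong (_+ (r′ + d₀)) (ℕ.+-comm w q₀) ⟩
      (q₀ + w) + (r′ + d₀)  ≡⟨ ℕ.+-assoc q₀ w _ ⟩
      q₀ + (w + (r′ + d₀))  ≡⟨ cong (q₀ +_) (ℕ.+-assoc w r′ d₀) ⟨
      q₀ + (w + r′ + d₀)    ≤⟨ ℕ.+-monoʳ-≤ q₀ (ℕ.+-monoˡ-≤ d₀
                                 (sum-map-decrease reserve-mono (∈-allFin y) (spent eq))) ⟩
      Φ s                   ∎)
    (λ _ → ℕ.+-monoʳ-≤ q₀ (ℕ.+-monoˡ-≤ d₀ (sum-map-mono (allFin q) reserve-mono)))
    where
    open ℕ.≤-Reasoning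
    s′ : State
    s′ = settle z y a s
    w q₀ r′ d₀ : ℕ
    w  = weight (node (inj₂ y))
    q₀ = sum (map (weight ∘ proj₁) (Q s))
    r′ = sum (map (reserve (count s′)) (allFin q))
    d₀ = sum (map (owed (done s)) (allFin p))
    reserve-y : reserve (count s) y ≡ w
    reserve-y with count s y
    ... | zero  = contradiction refl cnt≢0
    ... | suc _ = refl
    reserve≤ : ∀ y′ n → (if n ≡ᵇ 0 then 0 else weight (node (inj₂ y′))) ≤ weight (node (inj₂ y′))
    reserve≤ y′ zero    = z≤n
    reserve≤ y′ (suc _) = ℕ.≤-refl
    reserve-mono : ∀ y′ → reserve (count s′) y′ ≤ reserve (count s) y′
    reserve-mono y′ with y′ Fin.≟ y
    ... | no  _    = ℕ.≤-refl
    ... | yes refl = ℕ.≤-trans (reserve≤ y (pred (count s y))) (ℕ.≤-reflexive (sym reserve-y))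
    spent : count s′ y ≡ 0 → w + reserve (count s′) y ≤ reserve (count s) y
    spent eq rewrite eq = ℕ.≤-reflexive (trans (ℕ.+-identityʳ w) (sym reserve-y))

  -- Raising the flag frees the out-degree owed by `z`, which pays for having expanded it.
  Φ-finishNode : ∀ {z} s → done s z ≡ false → length (succ⁻ z) + Φ (finishNode z s) ≤ Φ s
  Φ-finishNode {z} s undone = begin
    g + (q₀ + (r₀ + d′))    ≡⟨ ℕ.+-assoc g q₀ _ ⟨
    g + q₀ + (r₀ + d′)      ≡⟨ cong (_+ (r₀ + d′)) (ℕ.+-comm g q₀) ⟩
    q₀ + g + (r₀ + d′)      ≡⟨ ℕ.+-assoc q₀ g _ ⟩
    q₀ + (g + (r₀ + d′))    ≡⟨ cong (q₀ +_) (ℕ.+-assoc g r₀ d′) ⟨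
    q₀ + (g + r₀ + d′)      ≡⟨ cong (λ n → q₀ + (n + d′)) (ℕ.+-comm g r₀) ⟩
    q₀ + (r₀ + g + d′)      ≡⟨ cong (q₀ +_) (ℕ.+-assoc r₀ g d′) ⟩
    q₀ + (r₀ + (g + d′))    ≤⟨ ℕ.+-monoʳ-≤ q₀ (ℕ.+-monoʳ-≤ r₀
                                 (sum-map-decrease owed-mono (∈-allFin z) paid)) ⟩
    Φ s                     ∎
    where
    open ℕ.≤-Reasoning
    g q₀ r₀ d′ : ℕ
    g  = length (succ⁻ z)
    q₀ = sum (map (weight ∘ proj₁) (Q s))
    r₀ = sum (map (reserve (count s)) (allFin q))
    d′ = sum (map (owed (done (finishNode z s))) (allFin p))
    owed-mono : ∀ x → owed (done (finishNode z s)) x ≤ owed (done s) x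
    owed-mono x with x Fin.≟ z
    ... | no  _ = ℕ.≤-refl
    ... | yes _ = z≤n
    paid : g + owed (done (finishNode z s)) z ≤ owed (done s) z
    paid = begin
      g + owed (done (finishNode z s)) z ≡⟨ cong (λ d → g + (if d then 0 else g)) (update-same Fin._≟_ z (done s)) ⟩
      g + 0                              ≡⟨ ℕ.+-identityʳ g ⟩
      g                                  ≡⟨ cong (if_then 0 else g) undone ⟨
      owed (done s) z                    ∎

  -- An unfinished min-node is at least at the level and every max-node at most at it, so this
  -- assignment lowers the mark of `x`, and lowers it to the level.
  mark-inv : ∀ {cur ℓ s z x} → Inv cur ℓ s → done s x ≡ false → M s (inj₂ z) ⊏ E⁺⁻ z x →
             count s z ≡ 0 → ℓ ⊑ M s (inj₂ z) →
             Inv ((node (inj₁ x) , M s (inj₂ z)) ∷ cur) ℓ (mark (inj₁ x) (M s (inj₂ z)) s)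
  mark-inv {cur} {ℓ} {s} {z} {x} inv undone lt cnt ℓ⊑a = record
    { keys    = keys
    ; level   = λ { (here refl) → ℓ⊑a ; (there o∈) → level o∈ }
    ; valid   = λ where
        (node (inj₁ x′) , k) o∈ → lift (⊑-trans (decreases x′) (Level.lower (valid _ o∈)))
        (node (inj₂ _) , _)  o∈ → valid _ o∈
        (edge _ _ , _)       o∈ → valid _ o∈
    ; pending = pending′
    ; max≤    = max≤
    ; done≤   = λ x′ d → M-elim (_⊑ ℓ) (λ _ → a⊑ℓ) (λ _ → done≤ x′ d)
    ; closed  = closed
    ; count≡  = count≡
    ; limit   = λ x′ → ⊑-trans (decreases x′) (limit x′)
    -- A witness may be the very node being lowered; it still supports `y`, as no max-node exceeds
    -- the level, to which it is lowered.
    ; support = λ y → Sum.map id (λ (z′ , ≤E , ≤M) → z′ , ≤E ,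
                    M-elim (M s (inj₂ y) ⊑_) (λ _ → ⊑-trans (max≤ y) ℓ⊑a) (λ _ → ≤M)) (support y)
    ; above⁻  = λ {M′} cor x′ → M-elim (M′ (inj₁ x′) ⊑_) (λ { refl → capped cor }) (λ _ → above⁻ cor x′)
    ; above⁺  = above⁺
    }
    where
    open Inv inv
    s′ : State
    s′ = mark (inj₁ x) (M s (inj₂ z)) s
    a⊑ℓ : M s (inj₂ z) ⊑ ℓ
    a⊑ℓ = max≤ z
    M-elim : ∀ {x′} (P : Carrier → Set r) → (x′ ≡ x → P (M s (inj₂ z))) → (x′ ≢ x → P (M s (inj₁ x′))) →
             P (M s′ (inj₁ x′))
    M-elim {x′ = x′} P same other = update-elim _≟V_ (inj₁ x) (M s) (inj₁ x′) P
      (λ { refl → same refl }) (λ neq → other λ { refl → neq refl })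
    decreases : ∀ x′ → M s′ (inj₁ x′) ⊑ M s (inj₁ x′)
    decreases x′ = M-elim (_⊑ M s (inj₁ x′))
      (λ { refl → ⊑-trans a⊑ℓ (undone≥ undone) }) (λ _ → ⊑-refl)
    pending′ : ∀ o → Finished s′ o ⊎
                     (o , key s′ o) ∈ Q s ++ (node (inj₁ x) , M s (inj₂ z)) ∷ cur
    pending′ (node (inj₁ x′)) with x′ Fin.≟ x
    ... | yes refl = inj₂ (now (Q s))
    ... | no  _    = Sum.map id (later (Q s)) (pending (node (inj₁ x′)))
    pending′ (node (inj₂ y)) =
      Sum.map (λ fin cnt x′ lt → ⊑-trans (decreases x′) (fin cnt x′ lt)) (later (Q s)) (pending (node (inj₂ y)))
    pending′ (edge z′ y) = Sum.map id (later (Q s)) (pending (edge z′ y))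
    capped : ∀ {M′} → Correct N M′ → M′ (inj₁ x) ⊑ M s (inj₂ z)
    capped {M′} cor = ⊑-trans
      -- The marking `M′` is below the mark of `z`, hence strictly below the edge value, so the
      -- implication in its min-clause evaluates to `M′ (inj₂ z)`.
      (subst (M′ (inj₁ x) ⊑_) (⇒-strict M′z⊏E)
        (⊑-trans (Correct.min cor x) (⋀-lower (λ z → E⁺⁻ z x ⇒ M′ (inj₂ z)) z)))
      (above-max inv cor cnt)
      where
      M′z⊏E : M′ (inj₂ z) ⊏ E⁺⁻ z x
      M′z⊏E = ≰⇒> λ E⊑ → <⇒≱ lt (⊑-trans E⊑ (above-max inv cor cnt))

  relax-inv : ∀ {cur ℓ s z x} → Inv cur ℓ s → count s z ≡ 0 → ℓ ⊑ M s (inj₂ z) → Inv cur ℓ (relax z s x)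
  relax-inv {cur} {ℓ} {s} {z} {x} inv cnt ℓ⊑a = relax-elim z s x (Inv cur ℓ)
    (λ undone lt → insert-inv (mark-inv inv undone lt cnt ℓ⊑a)
       (cong (λ m → (_ , m) ∷ cur) (sym (update-same _≟V_ (inj₁ x) (M s)))) (lift ⊑-refl))
    (λ _ → inv)

  relax-M⁺ : ∀ {z s x} y → M (relax z s x) (inj₂ y) ≡ M s (inj₂ y)
  relax-M⁺ {z} {s} {x} y = relax-elim z s x (λ s′ → M s′ (inj₂ y) ≡ M s (inj₂ y)) (λ _ _ → refl) (λ _ → refl)

  relax-count : ∀ {z s x} → count (relax z s x) ≡ count s
  relax-count {z} {s} {x} = relax-elim z s x (λ s′ → count s′ ≡ count s) (λ _ _ → refl) (λ _ → refl)

  relax-M⁻ : ∀ {cur ℓ z s x} → Inv cur ℓ s → ∀ x′ → M (relax z s x) (inj₁ x′) ⊑ M s (inj₁ x′)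
  relax-M⁻ {z = z} {s} {x} inv x′ = relax-elim z s x (λ s′ → M s′ (inj₁ x′) ⊑ M s (inj₁ x′))
    (λ undone _ → update-elim _≟V_ (inj₁ x) (M s) (inj₁ x′) (_⊑ M s (inj₁ x′))
       (λ { refl → ⊑-trans (Inv.max≤ inv z) (Inv.undone≥ inv undone) }) (λ _ → ⊑-refl))
    (λ _ → ⊑-refl)

  -- If the assignment is skipped although the comparison succeeds, then `x` is done, and done
  -- min-nodes lie below the level already.
  relax-settles : ∀ {cur ℓ z s x} → Inv cur ℓ s → ℓ ⊑ M s (inj₂ z) → M s (inj₂ z) ⊏ E⁺⁻ z x →
                  M (relax z s x) (inj₁ x) ⊑ M s (inj₂ z)
  relax-settles {z = z} {s} {x} inv ℓ⊑a lt = relax-elim z s x (λ s′ → M s′ (inj₁ x) ⊑ M s (inj₂ z))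
    (λ _ _ → subst (_⊑ M s (inj₂ z)) (sym (update-same _≟V_ (inj₁ x) (M s))) ⊑-refl)
    (λ d → ⊑-trans (Inv.done≤ inv x (d lt)) ℓ⊑a)

  -- Each `relax` reads the mark of `z` from the running state; `same⁺` ties all comparisons of the
  -- fold to one value.
  record Relaxed (cur : List Occurrence) (ℓ : Carrier) (z : Vmax) (xs : List Vmin) (s s′ : State) :
                 Set (c ⊔ ℓ₁ ⊔ ℓ₂) where
    field
      inv       : Inv cur ℓ s′
      same⁺     : M s′ (inj₂ z) ≡ M s (inj₂ z)
      decreases : ∀ x → M s′ (inj₁ x) ⊑ M s (inj₁ x)
      settles   : ∀ {x} → x ∈ xs → M s (inj₂ z) ⊏ E⁺⁻ z x → M s′ (inj₁ x) ⊑ M s (inj₂ z)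
      cost      : Φ s′ ≤ length xs + Φ s

  relax-all : ∀ {cur ℓ z} xs {s} → Inv cur ℓ s → count s z ≡ 0 → ℓ ⊑ M s (inj₂ z) →
              Relaxed cur ℓ z xs s (foldl (relax z) s xs)
  relax-all []       inv cnt ℓ⊑a = record
    { inv = inv ; same⁺ = refl ; decreases = λ _ → ⊑-refl ; settles = λ () ; cost = ℕ.≤-refl }
  relax-all {ℓ = ℓ} {z} (x ∷ xs) {s} inv cnt ℓ⊑a = record
    { inv       = rest.inv
    ; same⁺     = trans rest.same⁺ M≡
    ; decreases = λ x′ → ⊑-trans (rest.decreases x′) (relax-M⁻ inv x′)
    ; settles   = λ where
        (here refl) lt → ⊑-trans (rest.decreases x) (relax-settles inv ℓ⊑a lt)
        (there x∈)  lt → ⊑≡-trans (rest.settles x∈ (≡⊏-trans M≡ lt)) M≡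
    ; cost      = ℕ.≤-trans rest.cost (ℕ.≤-trans (ℕ.+-monoʳ-≤ (length xs) (Φ-relax z s x))
                    (ℕ.≤-reflexive (ℕ.+-suc (length xs) (Φ s))))
    }
    where
    M≡ : M (relax z s x) (inj₂ z) ≡ M s (inj₂ z)
    M≡ = relax-M⁺ {z} {s} {x} z
    module rest = Relaxed (relax-all xs (relax-inv {x = x} inv cnt ℓ⊑a)
      (trans (cong (λ f → f z) (relax-count {z} {s} {x})) cnt) (subst (ℓ ⊑_) (sym M≡) ℓ⊑a))

  record Visited (cur : List Occurrence) (ℓ : Carrier) (z : Vmin) (ys : List Vmax) (s s′ : State) :
                 Set (c ⊔ ℓ₁ ⊔ ℓ₂) where
    field
      inv      : Inv cur ℓ s′
      same⁻    : M s′ (inj₁ z) ≡ M s (inj₁ z)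
      same-done : done s′ ≡ done s
      grows    : ∀ {e} → edgeDone s e ≡ true → edgeDone s′ e ≡ true
      finishes : ∀ {y} → y ∈ ys → edgeDone s′ (z , y) ≡ true
      cost     : Φ s′ ≤ Φ s

  visit-one : ∀ {cur ℓ z y s} → Inv cur ℓ s → done s z ≡ false → M s (inj₁ z) ⊑ ℓ → 0# ⊏ E⁻⁺ z y →
              Visited cur ℓ z (y ∷ []) s (visit z s y)
  visit-one {cur} {ℓ} {z} {y} {s} inv undone a⊑ℓ pos = visit-elim z s y (Visited cur ℓ z (y ∷ []) s)
    (λ fresh → record
      { inv       = finishEdge-inv inv pos fresh (Inv.undone≥ inv undone) a⊑ℓ
          -- An open positive edge is still pending under its own value, which is therefore at least
          -- the level.
          (⊑-trans a⊑ℓ (Inv.pending≥ inv {edge z y} λ fin → case trans (sym fresh) (fin pos) of λ ()))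
          ⊑-refl (λ cor → ⊑-trans ⊗-lowerʳ (Inv.above⁻ inv cor z))
      ; same⁻     = finishEdge-elim z y (M s (inj₁ z)) s (λ s′ → M s′ (inj₁ z) ≡ M s (inj₁ z)) (λ _ → refl) (λ _ → refl)
      ; same-done = finishEdge-elim z y (M s (inj₁ z)) s (λ s′ → done s′ ≡ done s) (λ _ → refl) (λ _ → refl)
      ; grows     = λ {e} d → finishEdge-elim z y (M s (inj₁ z)) s (λ s′ → edgeDone s′ e ≡ true) (λ _ → grow d) (λ _ → grow d)
      ; finishes  = λ { (here refl) → finishEdge-elim z y (M s (inj₁ z)) s (λ s′ → edgeDone s′ (z , y) ≡ true)
                          (λ _ → update-same _≟E_ (z , y) (edgeDone s))
                          (λ _ → update-same _≟E_ (z , y) (edgeDone s)) }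
      ; cost      = Φ-finishEdge s (count-pos inv pos fresh)
      })
    (λ old → record
      { inv = inv ; same⁻ = refl ; same-done = refl ; grows = id ; finishes = λ { (here refl) → old }
      ; cost = ℕ.≤-refl })
    where
    grow : ∀ {e} → edgeDone s e ≡ true → update _≟E_ (z , y) true (edgeDone s) e ≡ true
    grow {e} d = update-elim _≟E_ (z , y) (edgeDone s) e (_≡ true) (λ _ → refl) (λ _ → d)

  visit-all : ∀ {cur ℓ z} ys {s} → Inv cur ℓ s → done s z ≡ false → M s (inj₁ z) ⊑ ℓ →
              All (λ y → 0# ⊏ E⁻⁺ z y) ys → Visited cur ℓ z ys s (foldl (visit z) s ys)
  visit-all []       inv undone a⊑ℓ [] = record
    { inv = inv ; same⁻ = refl ; same-done = refl ; grows = id ; finishes = λ () ; cost = ℕ.≤-refl }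
  visit-all {ℓ = ℓ} {z} (y ∷ ys) {s} inv undone a⊑ℓ (pos ∷ poss) = record
    { inv       = rest.inv
    ; same⁻     = trans rest.same⁻ first.same⁻
    ; same-done = trans rest.same-done first.same-done
    ; grows     = rest.grows ∘ first.grows
    ; finishes  = λ { (here refl) → rest.grows (first.finishes (here refl)) ; (there y∈) → rest.finishes y∈ }
    ; cost      = ℕ.≤-trans rest.cost first.cost
    }
    where
    module first = Visited (visit-one inv undone a⊑ℓ pos)
    module rest = Visited (visit-all ys first.inv (trans (cong (λ d → d z) first.same-done) undone)
      (subst (_⊑ ℓ) (sym first.same⁻) a⊑ℓ) poss)

  finishNode-inv : ∀ {cur ℓ s z} → Inv cur ℓ s → M s (inj₁ z) ⊑ ℓ →
                   (∀ {y} → 0# ⊏ E⁻⁺ z y → edgeDone s (z , y) ≡ true) → Inv cur ℓ (finishNode z s)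
  finishNode-inv {cur} {ℓ} {s} {z} inv a⊑ℓ all-done = record
    { Inv inv
    ; valid   = λ where
        (node (inj₁ _) , _) o∈ → valid _ o∈
        (node (inj₂ _) , _) o∈ → valid _ o∈
        (edge _ _ , _)      o∈ → valid _ o∈
    ; pending = pending′
    ; done≤   = done≤′
    ; closed  = closed′
    }
    where
    open Inv inv
    s′ : State
    s′ = finishNode z s
    pending′ : ∀ o → Finished s′ o ⊎ (o , key s′ o) ∈ Q s ++ cur
    pending′ (node (inj₁ x)) = Sum.map
      (λ (lift d) → lift (update-elim Fin._≟_ z (done s) x (_≡ true) (λ _ → refl) (λ _ → d))) id
      (pending (node (inj₁ x)))
    pending′ (node (inj₂ y)) = pending (node (inj₂ y))
    pending′ (edge z′ y)     = pending (edge z′ y)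
    done≤′ : ∀ x → done s′ x ≡ true → M s (inj₁ x) ⊑ ℓ
    done≤′ x d with x Fin.≟ z
    ... | yes refl = a⊑ℓ
    ... | no  _    = done≤ x d
    closed′ : ∀ {x} → done s′ x ≡ true → ∀ {y} → 0# ⊏ E⁻⁺ x y → edgeDone s (x , y) ≡ true
    closed′ {x} d with x Fin.≟ z
    ... | yes refl = all-done
    ... | no  _    = closed d

  succ⁻-positive : ∀ {z ys} → ys ↭ succ⁻ z → All (λ y → 0# ⊏ E⁻⁺ z y) ys
  succ⁻-positive {z} perm = Perm.All-resp-↭ (↭-sym perm) (All.all-filter (λ y → 0# ⊏? E⁻⁺ z y) (allFin q))

  -- Machine time is measured in these units up to a constant factor. Since no iteration is free,
  -- the same accounting yields termination.
  work : ∀ {o s s′} → Process o s s′ → ℕ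
  work (max-node {z} _)   = suc (length (succ⁺ z))
  work (min-node {z} _ _) = suc (length (succ⁻ z))
  work (min-skip _)       = 1
  work (edge-new _)       = 1
  work (edge-skip _)      = 1

  process-inv : ∀ {o k s s′} → Inv ((o , k) ∷ []) k s → Valid s (o , k) → (step : Process o s s′) →
                Inv [] k s′ × work step + Φ s′ ≤ weight o + Φ s
  process-inv {k = k} {s} inv (lift (cnt , M≡k)) (max-node {z} {xs = xs} perm) =
    drop-inv R.inv refl (λ _ x lt → ⊑≡-trans (settled x (≡⊏-trans (sym R.same⁺) lt)) (sym R.same⁺)) ,
    s≤s (begin
      g + Φ s′        ≤⟨ ℕ.+-monoʳ-≤ g R.cost ⟩
      g + (length xs + Φ s) ≡⟨ cong (λ n → g + (n + Φ s)) (Perm.↭-length perm) ⟩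
      g + (g + Φ s)   ≡⟨ ℕ.+-assoc g g (Φ s) ⟨
      g + g + Φ s     ∎)
    where
    open ℕ.≤-Reasoning
    g : ℕ
    g = length (succ⁺ z)
    s′ : State
    s′ = foldl (relax z) s xs
    module R = Relaxed (relax-all xs inv cnt (reflexive (Eq.reflexive (sym M≡k))))
    settled : ∀ x → M s (inj₂ z) ⊏ E⁺⁻ z x → M s′ (inj₁ x) ⊑ M s (inj₂ z)
    -- An edge value strictly above some mark is positive, so `x` is among the successors visited by
    -- the fold.
    settled x lt = R.settles (Perm.∈-resp-↭ (↭-sym perm) (∈-filter⁺ (λ x → 0# ⊏? E⁺⁻ z x) (∈-allFin x) pos)) lt
      where
      pos : 0# ⊏ E⁺⁻ z x
      pos = ≰⇒> λ E⊑0 → <⇒≱ lt (⊑-trans E⊑0 (minimum _))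
  process-inv {k = k} {s} inv (lift M⊑k) (min-node {z} {ys = ys} undone perm) =
    drop-inv (finishNode-inv V.inv (subst (_⊑ k) (sym V.same⁻) M⊑k) finished) refl
      (lift (update-same Fin._≟_ z (done (foldl (visit z) s ys)))) ,
    s≤s (ℕ.≤-trans (Φ-finishNode (foldl (visit z) s ys) (trans (cong (λ d → d z) V.same-done) undone)) V.cost)
    where
    module V = Visited (visit-all ys inv undone M⊑k (succ⁻-positive perm))
    finished : ∀ {y} → 0# ⊏ E⁻⁺ z y → edgeDone (foldl (visit z) s ys) (z , y) ≡ true
    finished pos = V.finishes
      (Perm.∈-resp-↭ (↭-sym perm) (∈-filter⁺ (λ y → 0# ⊏? E⁻⁺ z y) (∈-allFin _) pos))
  process-inv inv val (min-skip d) = drop-inv inv refl (lift d) , ℕ.≤-refl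
  process-inv {k = k} {s} inv (pos , refl) (edge-new {z} {y} fresh) =
    drop-inv (finishEdge-inv inv pos fresh ⊑-refl ⊑-refl ⊑-refl (Inv.undone≥ inv undone) (λ _ → ⊗-lowerˡ)) refl
      (λ _ → finishEdge-elim z y (E⁻⁺ z y) s (λ s′ → edgeDone s′ (z , y) ≡ true)
         (λ _ → update-same _≟E_ (z , y) (edgeDone s)) (λ _ → update-same _≟E_ (z , y) (edgeDone s))) ,
    s≤s (Φ-finishEdge s (count-pos inv pos fresh))
    where
    -- A done source would have closed this edge by `closed`. Hence the source is undone and its
    -- mark is at least the extracted key, which is the edge value.
    undone : done s z ≡ false
    undone with done s z in d
    ... | false = refl
    ... | true  = contradiction (trans (sym fresh) (Inv.closed inv d pos)) λ ()
  process-inv inv val (edge-skip d) = drop-inv inv refl (λ _ → d) , ℕ.≤-refl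

-- Termination, progress and the final marking.

module Correctness {c ℓ₁ ℓ₂} (chain : BoundedChain c ℓ₁ ℓ₂) (N : Minimax.Net chain) where
  open Gödel chain
  open Step chain N public

  -- Extraction removes `weight o` from the potential, and this is the budget of `process-inv`.
  step-inv : ∀ {ℓ s s′ o k Q′} → Inv [] ℓ s → Q s ↭ (o , k) ∷ Q′ → All (λ occ → k ⊑ proj₂ occ) Q′ →
             (step : Process o (record s { Q = Q′ }) s′) → Inv [] k s′ × work step + Φ s′ ≤ Φ s
  step-inv {s = s} {s′} {o} {k} {Q′} inv perm least step =
    Product.map₂ (λ le → ℕ.≤-trans le (ℕ.≤-reflexive weight-split))
      (process-inv (extract-inv inv perm least) (valid′ o (Inv.valid inv _ (Perm.∈-resp-↭ (↭-sym perm) (here refl)))) step)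
    where
    valid′ : ∀ o → Valid s (o , k) → Valid (record s { Q = Q′ }) (o , k)
    valid′ (node (inj₁ _)) val = val
    valid′ (node (inj₂ _)) val = val
    valid′ (edge _ _)      val = val
    weight-split : weight o + Φ (record s { Q = Q′ }) ≡ Φ s
    weight-split = trans (sym (ℕ.+-assoc (weight o) _ _))
      (cong (_+ (sum (map (reserve (count s)) (allFin q)) + sum (map (owed (done s)) (allFin p))))
        (sym (sum-↭ (Perm.map⁺ (weight ∘ proj₁) perm))))

  work>0 : ∀ {o s s′} (step : Process o s s′) → 0 < work step
  work>0 (max-node _)   = z<s
  work>0 (min-node _ _) = z<s
  work>0 (min-skip _)   = z<s
  work>0 (edge-new _)   = z<s
  work>0 (edge-skip _)  = z<s

  Reachable : State → Set (c ⊔ ℓ₁ ⊔ ℓ₂)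
  Reachable s = ∃ λ ℓ → Inv [] ℓ s

  ⟶-decreases : ∀ {s s′} → Reachable s → s ⟶ s′ → Reachable s′ × Φ s′ < Φ s
  ⟶-decreases (ℓ , inv) (extract perm least step) with step-inv inv perm least step
  ... | inv′ , le = (_ , inv′) , ℕ.≤-trans (ℕ.+-monoˡ-≤ _ (work>0 step)) le

  ⟶*-reachable : ∀ {s s′} → Reachable s → s ⟶* s′ → Reachable s′
  ⟶*-reachable reach ε            = reach
  ⟶*-reachable reach (st ◅ steps) = ⟶*-reachable (proj₁ (⟶-decreases reach st)) steps

  accessible : ∀ n {s} → Φ s < n → Reachable s → Acc (flip _⟶_) s
  accessible (suc n) (s≤s Φs≤n) reach = acc λ st →
    let reach′ , lt = ⟶-decreases reach st in accessible n (ℕ.≤-trans lt Φs≤n) reach′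

  -- At the start `above⁻` is the limit clause of a correct marking, and `above⁺` is vacuous because
  -- no edge is settled.
  initial-inv : Inv [] 0# initial
  initial-inv = record
    { keys    = λ _ → minimum _
    ; level   = λ ()
    ; valid   = valid′
    ; pending = λ o → Sum.map₂ ∈-++⁺ˡ (pending′ o)
    ; max≤    = λ _ → ⊑-refl
    ; done≤   = λ _ ()
    ; closed  = λ ()
    ; count≡  = λ y → sym (#false-all (pred⁺ y) λ _ → refl)
    ; limit   = λ _ → ⊑-refl
    ; support = λ _ → inj₁ ⊑-refl
    ; above⁻  = λ cor x → Correct.limit cor x
    ; above⁺  = λ _ ()
    }
    where
    mins maxs edges : List Occurrence
    mins  = map (λ x → node (inj₁ x) , L x) (allFin p)
    maxs  = map (λ y → node (inj₂ y) , 0#) (filter (λ y → count initial y ℕ.≟ 0) (allFin q))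
    edges = map (λ (z , y) → edge z y , E⁻⁺ z y) edges⁻⁺

    valid′ : ∀ o → o ∈ Q initial → Valid initial o
    valid′ o o∈ with ∈-++⁻ mins o∈
    ... | inj₁ o∈mins with _ , _ , refl ← ∈-map⁻ _ o∈mins = lift ⊑-refl
    ... | inj₂ o∈rest with ∈-++⁻ maxs o∈rest
    ...   | inj₁ o∈maxs with _ , y∈ , refl ← ∈-map⁻ _ o∈maxs =
      lift (proj₂ (∈-filter⁻ (λ y → count initial y ℕ.≟ 0) {xs = allFin q} y∈) , refl)
    ...   | inj₂ o∈edges with _ , e∈ , refl ← ∈-map⁻ _ o∈edges =
      proj₂ (∈-filter⁻ (λ e → 0# ⊏? E⁻⁺ (proj₁ e) (proj₂ e))
               {xs = cartesianProduct (allFin p) (allFin q)} e∈) , refl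

    pending′ : ∀ o → Finished initial o ⊎ (o , key initial o) ∈ Q initial
    pending′ (node (inj₁ x)) = inj₂ (∈-++⁺ˡ (∈-map⁺ (λ x → node (inj₁ x) , L x) (∈-allFin x)))
    pending′ (node (inj₂ y)) with count initial y ℕ.≟ 0
    ... | no  neq = inj₁ λ eq → contradiction eq neq
    ... | yes eq  = inj₂ (∈-++⁺ʳ mins (∈-++⁺ˡ (∈-map⁺ (λ y → node (inj₂ y) , 0#)
                      (∈-filter⁺ (λ y → count initial y ℕ.≟ 0) (∈-allFin y) eq))))
    pending′ (edge z y) with 0# ⊏? E⁻⁺ z y
    ... | no  ¬pos = inj₁ λ pos → contradiction pos ¬pos
    ... | yes pos  = inj₂ (∈-++⁺ʳ mins (∈-++⁺ʳ maxs (∈-map⁺ (λ (z , y) → edge z y , E⁻⁺ z y)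
                       (∈-filter⁺ (λ e → 0# ⊏? E⁻⁺ (proj₁ e) (proj₂ e))
                          (∈-cartesianProduct⁺ (∈-allFin z) (∈-allFin y)) pos))))

  extract-min : ∀ o (Q : List Occurrence) →
                ∃[ o′ ] ∃[ Q′ ] (o ∷ Q ↭ o′ ∷ Q′ × All (λ occ → proj₂ o′ ⊑ proj₂ occ) Q′)
  extract-min o []       = o , [] , ↭-refl , []
  extract-min o (o₁ ∷ Q) with extract-min o₁ Q
  ... | o′ , Q′ , perm , least with total (proj₂ o) (proj₂ o′)
  ...   | inj₁ o⊑o′ = o , o₁ ∷ Q , ↭-refl ,
    Perm.All-resp-↭ (↭-sym perm) (o⊑o′ ∷ All.map (⊑-trans o⊑o′) least)
  ...   | inj₂ o′⊑o = o′ , o ∷ Q′ , ↭-trans (prep o perm) (_↭_.swap o o′ ↭-refl) , o′⊑o ∷ least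

  process : ∀ o s → ∃ λ s′ → Process o s s′
  process (node (inj₂ z)) s = _ , max-node ↭-refl
  process (node (inj₁ z)) s with done s z in d
  ... | true  = _ , min-skip d
  ... | false = _ , min-node d ↭-refl
  process (edge z y) s with edgeDone s (z , y) in d
  ... | true  = _ , edge-skip d
  ... | false = _ , edge-new d

  progress : ∀ s → Q s ≢ [] → ∃[ s′ ] s ⟶ s′
  progress s nonempty with Q s in eq
  ... | [] = contradiction refl nonempty
  ... | o ∷ Q₀ with extract-min o Q₀
  ...   | (o′ , k) , Q′ , perm , least =
    Product.map₂ (extract (subst (_↭ _) (sym eq) perm) least) (process o′ (record s { Q = Q′ }))

  -- With nothing queued and nothing in progress, `pending` makes every object finished. Finished
  -- edges bring all counters to zero, and this activates the condition inside `Finished` at every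
  -- max-node.
  greatest : ∀ {s} → Reachable s → Q s ≡ [] → IsGreatestCorrect N (M s)
  greatest {s} (ℓ , inv) empty = correct , above
    where
    open Inv inv
    finished : ∀ o → Finished s o
    finished o with pending o
    ... | inj₁ fin = fin
    ... | inj₂ o∈ with () ← subst (λ Q → (o , key s o) ∈ Q ++ []) empty o∈
    count-zero : ∀ y → count s y ≡ 0
    count-zero y = trans (count≡ y) (#false-none (All.tabulate λ z∈ →
      finished (edge _ y) (proj₂ (∈-filter⁻ (λ z → 0# ⊏? E⁻⁺ z y) {xs = allFin p} z∈))))
    supported : ∀ y → M s (inj₂ y) ⊑ ⋁ (λ z → E⁻⁺ z y ⊗ M s (inj₁ z))
    supported y with support y
    ... | inj₁ ⊑0              = ⊑-trans ⊑0 (minimum _)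
    ... | inj₂ (z , ⊑E , ⊑M) = ⊑-trans (⊗-greatest ⊑E ⊑M) (⋁-upper (λ z → E⁻⁺ z y ⊗ M s (inj₁ z)) z)
    correct : Correct N (M s)
    correct = record
      { limit = limit
      ; min   = λ x → ⋀-greatest λ z → ⇒-intro λ lt → finished (node (inj₂ z)) (count-zero z) x lt
      ; max   = supported
      }
    above : ∀ M′ → Correct N M′ → ∀ v → M′ v ⊑ M s v
    above M′ cor (inj₁ x) = above⁻ cor x
    above M′ cor (inj₂ y) = above-max inv cor (count-zero y)

  returns : Returns (IsGreatestCorrect N)
  returns = record
    { terminates = accessible (suc (Φ initial)) ℕ.≤-refl (0# , initial-inv)
    ; progress   = λ {s} _ → progress s
    ; result     = λ steps → greatest (⟶*-reachable (0# , initial-inv) steps)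
    }

-- Arrays and linked lists

-- A write on the machine matches a write in the abstract state as soon as hitting the written index
-- and hitting the written object imply each other; `h` encodes the values.
update-sim : ∀ {A : Set a} {B : Set b} {C : Set r} {D : Set r}
             (_≟₁_ : DecidableEquality A) (_≟₂_ : DecidableEquality B) (h : D → C)
             {x x′ y y′ v w} (f : A → C) (g : B → D) →
             (x′ ≡ x → y′ ≡ y) → (y′ ≡ y → x′ ≡ x) → v ≡ h w → f x′ ≡ h (g y′) →
             update _≟₁_ x v f x′ ≡ h (update _≟₂_ y w g y′)
update-sim _≟₁_ _≟₂_ h {x} {x′} {y} {y′} f g to from v≡w f≡g with x′ ≟₁ x | y′ ≟₂ y
... | yes _   | yes _   = v≡w
... | no  _   | no  _   = f≡g
... | yes eq  | no  neq = contradiction (to eq) neq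
... | no  neq | yes eq  = contradiction (from eq) neq

-- A relation instead of a lookup function, because machine positions are bare natural numbers
-- without a bound attached.
data At {A : Set a} : List A → ℕ → A → Set a where
  here  : ∀ {x xs} → At (x ∷ xs) 0 x
  there : ∀ {x y xs i} → At xs i x → At (y ∷ xs) (suc i) x

At-∈ : ∀ {xs i} {x : A} → At xs i x → x ∈ xs
At-∈ here       = here refl
At-∈ (there at) = there (At-∈ at)

At-lookup : (xs : List A) (i : Fin (length xs)) → At xs (toℕ i) (lookup xs i)
At-lookup (x ∷ xs) Fin.zero    = here
At-lookup (x ∷ xs) (Fin.suc i) = there (At-lookup xs i)

At-functional : ∀ {xs i} {x y : A} → At xs i x → At xs i y → x ≡ y
At-functional here       here        = refl
At-functional (there at) (there at′) = At-functional at at′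

At-injective : ∀ {xs i j} {x : A} → Unique xs → At xs i x → At xs j x → i ≡ j
At-injective xs!         here       here        = refl
At-injective (x∉ ∷ _)    here       (there at)  = contradiction refl (All.lookup x∉ (At-∈ at))
At-injective (x∉ ∷ _)    (there at) here        = contradiction refl (All.lookup x∉ (At-∈ at))
At-injective (_ ∷ xs!)   (there at) (there at′) = cong suc (At-injective xs! at at′)

At-tabulate : ∀ {n} (f : Fin n → A) i → At (Data.List.Base.tabulate f) (toℕ i) (f i)
At-tabulate f Fin.zero    = here
At-tabulate f (Fin.suc i) = there (At-tabulate (f ∘ Fin.suc) i)

At-allFin : ∀ {n i} {x : Fin n} → At (allFin n) i x → i ≡ toℕ x
At-allFin {n} {x = x} at = At-injective (Unique.allFin⁺ n) at (At-tabulate id x)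

data Suffix {A : Set a} : List A → ℕ → List A → Set a where
  here  : ∀ {xs} → Suffix xs 0 xs
  there : ∀ {x xs n ys} → Suffix xs n ys → Suffix (x ∷ xs) (suc n) ys

Suffix-At : ∀ {xs n y} {ys : List A} → Suffix xs n (y ∷ ys) → At xs n y
Suffix-At here        = here
Suffix-At (there suf) = there (Suffix-At suf)

Suffix-next : ∀ {xs n y} {ys : List A} → Suffix xs n (y ∷ ys) → Suffix xs (suc n) ys
Suffix-next here        = there here
Suffix-next (there suf) = there (Suffix-next suf)

Suffix-< : ∀ {xs n y} {ys : List A} → Suffix xs n (y ∷ ys) → (n <ᵇ length xs) ≡ true
Suffix-< here        = refl
Suffix-< (there suf) = Suffix-< suf

Suffix-≮ : ∀ {n} {xs : List A} → Suffix xs n [] → (n <ᵇ length xs) ≡ false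
Suffix-≮ here        = refl
Suffix-≮ (there suf) = Suffix-≮ suf

Suffix-nonempty : ∀ {n} {xs ys : List A} → Suffix xs n ys → (n <ᵇ length xs) ≡ not (null ys)
Suffix-nonempty {ys = []}    suf = Suffix-≮ suf
Suffix-nonempty {ys = _ ∷ _} suf = Suffix-< suf

Suffix-length : ∀ {n} {xs : List A} → Suffix xs n [] → n ≡ length xs
Suffix-length here        = refl
Suffix-length (there suf) = cong suc (Suffix-length suf)

module _ {A : Set a} {B : Set b} where

  -- Chain es next x n h ys: following next from h visits edges of es with
  -- source x, targets ys and positions below n; 0 ends the chain and suc i
  -- refers to the edge at position i.
  data Chain (es : List (A × B)) (next : ℕ → ℕ) (x : A) (n : ℕ) : ℕ → List B → Set (a ⊔ b) where
    nil  : Chain es next x n 0 []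
    link : ∀ {i y ys} → At es i (x , y) → i < n → Chain es next x n (next i) ys →
           Chain es next x n (suc i) (y ∷ ys)

  Chain-cong : ∀ {es next next′ x n h ys} → (∀ i → next′ i ≡ next i) →
               Chain es next x n h ys → Chain es next′ x n h ys
  Chain-cong eq nil                 = nil
  Chain-cong {es} {next′ = next′} {x} {n} eq (link {i} {ys = ys} at i<n rest) =
    link at i<n (subst (λ h → Chain es next′ x n h ys) (sym (eq i)) (Chain-cong eq rest))

  Chain-head : ∀ {es next x n h h′ ys} → h ≡ h′ →
               Chain es next x n h ys → Chain es next x n h′ ys
  Chain-head refl ch = ch

  -- All links stay at positions below `n`, so a write at `n` cannot disturb them; the bound in
  -- `link` exists for this purpose.
  Chain-update : ∀ {es next x n v h ys} → Chain es next x n h ys →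
                 Chain es (update ℕ._≟_ n v next) x (suc n) h ys
  Chain-update nil = nil
  Chain-update {es} {next} {x} {n} {ys = y ∷ ys} (link {i} at i<n rest) =
    link at (ℕ.m<n⇒m<1+n i<n)
      (subst (λ h → Chain es (update ℕ._≟_ n _ next) x (suc n) h ys)
        (sym (update-other ℕ._≟_ n next i (ℕ.<⇒≢ i<n))) (Chain-update rest))

module _ {k : ℕ} {B : Set b} where

  targets : Fin k → List (Fin k × B) → List B
  targets x es = map proj₂ (filter (λ e → proj₁ e Fin.≟ x) es)

  targets-hit : ∀ x y es → targets x ((x , y) ∷ es) ≡ y ∷ targets x es
  targets-hit x y es = cong (map proj₂) (List.filter-accept (λ e → proj₁ e Fin.≟ x) {x = x , y} refl)

  targets-miss : ∀ {x z} y es → z ≢ x → targets z ((x , y) ∷ es) ≡ targets z es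
  targets-miss {x} {z} y es z≢x = cong (map proj₂) (List.filter-reject (λ e → proj₁ e Fin.≟ z) {x = x , y} (z≢x ∘ sym))

  targets-↭ : ∀ x {es fs} → es ↭ fs → targets x es ↭ targets x fs
  targets-↭ x perm = Perm.map⁺ proj₂ (Perm.filter-↭ (λ e → proj₁ e Fin.≟ x) perm)

  targets-++ : ∀ x es fs → targets x (es ++ fs) ≡ targets x es ++ targets x fs
  targets-++ x es fs = trans (cong (map proj₂) (List.filter-++ (λ e → proj₁ e Fin.≟ x) es fs))
    (List.map-++ proj₂ (filter (λ e → proj₁ e Fin.≟ x) es) _)

  targets-row : ∀ x (ys : List B) → targets x (map (x ,_) ys) ≡ ys
  targets-row x []       = refl
  targets-row x (y ∷ ys) = trans (targets-hit x y (map (x ,_) ys)) (cong (y ∷_) (targets-row x ys))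

  targets-other-row : ∀ {x z} (ys : List B) → z ≢ x → targets z (map (x ,_) ys) ≡ []
  targets-other-row []       z≢x = refl
  targets-other-row {x} (y ∷ ys) z≢x = trans (targets-miss y (map (x ,_) ys) z≢x) (targets-other-row ys z≢x)

  -- The first n edges of es have been entered into the chains, those of rest
  -- have not.
  Linked : List (Fin k × B) → (head next : ℕ → ℕ) → ℕ → List (Fin k × B) → Set b
  Linked es head next n rest =
    ∀ z → ∃[ ys ] Chain es next z n (head (toℕ z)) ys × ys ++ targets z rest ↭ targets z es

  -- The edge at position `n` is put in front of the chain of its source. Chains thus come out in
  -- reverse order, which is harmless because successors may be traversed in any order.
  Linked-step : ∀ {es head next n x y rest h} → At es n (x , y) → h ≡ toℕ x →
                Linked es head next n ((x , y) ∷ rest) →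
                Linked es (update ℕ._≟_ h (suc n) head) (update ℕ._≟_ n (head h) next) (suc n) rest
  Linked-step {es} {head} {next} {n} {x} {y} {rest} at refl linked z with linked z | z Fin.≟ x
  ... | ys , chain , perm | yes refl = y ∷ ys , extended , ↭-trans (↭-sym (Perm.shift y ys _))
          (subst (λ ts → ys ++ ts ↭ targets z es) (targets-hit z y rest) perm)
    where
    extended : Chain es (update ℕ._≟_ n (head (toℕ z)) next) z (suc n)
                 (update ℕ._≟_ (toℕ z) (suc n) head (toℕ z)) (y ∷ ys)
    extended rewrite update-same ℕ._≟_ (toℕ z) {suc n} head = link at (ℕ.n<1+n n)
      (subst (λ h → Chain es (update ℕ._≟_ n (head (toℕ z)) next) z (suc n) h ys)
        (sym (update-same ℕ._≟_ n next)) (Chain-update chain))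
  ... | ys , chain , perm | no z≢x = ys ,
    subst (λ h → Chain es (update ℕ._≟_ n (head (toℕ x)) next) z (suc n) h ys)
      (sym (update-other ℕ._≟_ (toℕ x) head (toℕ z) (z≢x ∘ Fin.toℕ-injective))) (Chain-update chain) ,
    subst (λ ts → ys ++ ts ↭ targets z es) (targets-miss y rest z≢x) perm

  Linked-complete : ∀ {es head next n} → n ≡ length es → Linked es head next n [] →
                    ∀ z → ∃[ ys ] Chain es next z (length es) (head (toℕ z)) ys × ys ↭ targets z es
  Linked-complete refl linked z with linked z
  ... | ys , ch , perm = ys , ch , subst (_↭ _) (List.++-identityʳ ys) perm

-- Sums of weights and in-degrees of edge lists.

Unique-↭ : ∀ {xs ys : List A} → xs ↭ ys → Unique xs → Unique ys
Unique-↭ perm = SetoidPerm.Unique-resp-↭ (setoid _) (↭⇒↭ₛ perm)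

sum-map-one : (xs : List A) → sum (map (const 1) xs) ≡ length xs
sum-map-one []       = refl
sum-map-one (x ∷ xs) = cong suc (sum-map-one xs)

sum-map-double : (f : A → ℕ) (xs : List A) →
                 sum (map (λ x → suc (f x + f x)) xs) ≡ length xs + (sum (map f xs) + sum (map f xs))
sum-map-double f []       = refl
sum-map-double f (x ∷ xs) = cong suc (trans (cong (f x + f x +_) (sum-map-double f xs))
  (solve 3 (λ u n w → u :+ u :+ (n :+ (w :+ w)) :≡ n :+ ((u :+ w) :+ (u :+ w))) refl (f x) (length xs) (sum (map f xs))))

sum-map-filter : ∀ {P : A → Set r} (P? : ∀ x → Dec (P x)) (f : A → ℕ) xs →
                 sum (map f (filter P? xs)) ≤ sum (map f xs)
sum-map-filter P? f []       = z≤n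
sum-map-filter P? f (x ∷ xs) with does (P? x)
... | true  = ℕ.+-monoʳ-≤ (f x) (sum-map-filter P? f xs)
... | false = ℕ.≤-trans (sum-map-filter P? f xs) (ℕ.m≤n+m _ (f x))

module _ {A : Set a} {l : ℕ} where

  -- The machine computes counters by reading edges and looking at their targets, whereas the
  -- algorithm takes the number of predecessors; this count mediates between the two.
  into : Fin l → List (A × Fin l) → ℕ
  into y es = length (filter (λ e → proj₂ e Fin.≟ y) es)

  into-hit : ∀ (x : A) y es → into y ((x , y) ∷ es) ≡ suc (into y es)
  into-hit x y es = cong length (List.filter-accept (λ e → proj₂ e Fin.≟ y) {x = x , y} refl)

  into-miss : ∀ (x : A) {y y′} (es : List (A × Fin l)) → y ≢ y′ → into y ((x , y′) ∷ es) ≡ into y es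
  into-miss x {y} {y′} es y≢y′ = cong length (List.filter-reject (λ e → proj₂ e Fin.≟ y) {x = x , y′} (y≢y′ ∘ sym))

  into-++ : ∀ y (es fs : List (A × Fin l)) → into y (es ++ fs) ≡ into y es + into y fs
  into-++ y es fs = trans (cong length (List.filter-++ (λ e → proj₂ e Fin.≟ y) es fs))
    (List.length-++ (filter (λ e → proj₂ e Fin.≟ y) es))

  into-row-absent : ∀ (x : A) {y : Fin l} ys → All (y ≢_) ys → into y (map (x ,_) ys) ≡ 0
  into-row-absent x []       []           = refl
  into-row-absent x (y′ ∷ ys) (neq ∷ neqs) =
    trans (into-miss x {y′ = y′} (map (x ,_) ys) neq) (into-row-absent x ys neqs)

  into-row-present : ∀ (x : A) {y : Fin l} ys → Unique ys → y ∈ ys → into y (map (x ,_) ys) ≡ 1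
  into-row-present x (y ∷ ys) (y∉ ∷ _) (here refl) =
    trans (into-hit x y (map (x ,_) ys)) (cong suc (into-row-absent x ys y∉))
  into-row-present x (y′ ∷ ys) (y∉ ∷ ys!) (there y∈) =
    trans (into-miss x {y′ = y′} (map (x ,_) ys) (λ { refl → All.lookup y∉ y∈ refl })) (into-row-present x ys ys! y∈)

  into-↭ : ∀ y {es fs : List (A × Fin l)} → es ↭ fs → into y es ≡ into y fs
  into-↭ y perm = Perm.↭-length (Perm.filter-↭ (λ e → proj₂ e Fin.≟ y) perm)

-- Lists of positive edges, analysed row by row.

module Positive {c ℓ₁ ℓ₂} (chain : BoundedChain c ℓ₁ ℓ₂) {k l : ℕ}
                (F : Fin k → Fin l → BoundedChain.Carrier chain) where
  open Gödel chain

  pos? : (e : Fin k × Fin l) → Dec (0# ⊏ F (proj₁ e) (proj₂ e))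
  pos? e = 0# ⊏? F (proj₁ e) (proj₂ e)

  row : ∀ x ys → filter pos? (map (x ,_) ys) ≡ map (x ,_) (filter (λ y → 0# ⊏? F x y) ys)
  row x []       = refl
  row x (y ∷ ys) with does (0# ⊏? F x y)
  ... | true  = cong ((x , y) ∷_) (row x ys)
  ... | false = row x ys

  rows : ∀ x xs ys → filter pos? (cartesianProduct (x ∷ xs) ys) ≡
                     map (x ,_) (filter (λ y → 0# ⊏? F x y) ys) ++ filter pos? (cartesianProduct xs ys)
  rows x xs ys = trans (List.filter-++ pos? (map (x ,_) ys) _) (cong (_++ filter pos? (cartesianProduct xs ys)) (row x ys))

  targets-absent : ∀ {z} xs ys → All (z ≢_) xs → targets z (filter pos? (cartesianProduct xs ys)) ≡ []
  targets-absent []       ys []           = refl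
  targets-absent {z} (x ∷ xs) ys (z≢x ∷ z∉xs) = begin
    targets z (filter pos? (cartesianProduct (x ∷ xs) ys))         ≡⟨ cong (targets z) (rows x xs ys) ⟩
    targets z (first ++ filter pos? (cartesianProduct xs ys))      ≡⟨ targets-++ z first _ ⟩
    targets z first ++ targets z (filter pos? (cartesianProduct xs ys))
      ≡⟨ cong₂ _++_ (targets-other-row (filter (λ y → 0# ⊏? F x y) ys) z≢x) (targets-absent xs ys z∉xs) ⟩
    []                                                             ∎
    where
    open ≡-Reasoning
    first : List (Fin k × Fin l)
    first = map (x ,_) (filter (λ y → 0# ⊏? F x y) ys)

  targets-product : ∀ {z} xs ys → Unique xs → z ∈ xs →
                    targets z (filter pos? (cartesianProduct xs ys)) ≡ filter (λ y → 0# ⊏? F z y) ys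
  targets-product {z} (x ∷ xs) ys (x∉xs ∷ xs!) z∈ =
    trans (trans (cong (targets z) (rows x xs ys)) (targets-++ z first _)) (split z∈)
    where
    first : List (Fin k × Fin l)
    first = map (x ,_) (filter (λ y → 0# ⊏? F x y) ys)
    split : z ∈ x ∷ xs → targets z first ++ targets z (filter pos? (cartesianProduct xs ys)) ≡
                         filter (λ y → 0# ⊏? F z y) ys
    split (here refl) = trans (cong₂ _++_ (targets-row x (filter (λ y → 0# ⊏? F x y) ys)) (targets-absent xs ys x∉xs))
                              (List.++-identityʳ (filter (λ y → 0# ⊏? F x y) ys))
    split (there z∈)  = cong₂ _++_
      (targets-other-row (filter (λ y → 0# ⊏? F x y) ys) (λ { refl → All.lookup x∉xs z∈ refl }))
      (targets-product xs ys xs! z∈)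

  targets-positives : ∀ z → targets z (positives F) ≡ filter (λ y → 0# ⊏? F z y) (allFin l)
  targets-positives z = targets-product (allFin k) (allFin l) (Unique.allFin⁺ k) (∈-allFin z)

  positives-unique : Unique (positives F)
  positives-unique = Unique.filter⁺ pos? (Unique.cartesianProduct⁺ (Unique.allFin⁺ k) (Unique.allFin⁺ l))

  -- The degree sum formula: it turns the out-degrees in the initial potential into a number of
  -- edges.
  length-product : ∀ xs ys → sum (map (λ x → length (filter (λ y → 0# ⊏? F x y) ys)) xs) ≡
                             length (filter pos? (cartesianProduct xs ys))
  length-product []       ys = refl
  length-product (x ∷ xs) ys = sym (begin
    length (filter pos? (cartesianProduct (x ∷ xs) ys)) ≡⟨ cong length (rows x xs ys) ⟩
    length (map (x ,_) fs ++ rest)        ≡⟨ List.length-++ (map (x ,_) fs) ⟩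
    length (map (x ,_) fs) + length rest  ≡⟨ cong₂ _+_ (List.length-map (x ,_) fs) (sym (length-product xs ys)) ⟩
    length fs + sum (map (λ x → length (filter (λ y → 0# ⊏? F x y) ys)) xs) ∎)
    where
    open ≡-Reasoning
    fs : List (Fin l)
    fs = filter (λ y → 0# ⊏? F x y) ys
    rest : List (Fin k × Fin l)
    rest = filter pos? (cartesianProduct xs ys)

  into-product : ∀ y xs → into y (filter pos? (cartesianProduct xs (allFin l))) ≡
                          length (filter (λ x → 0# ⊏? F x y) xs)
  into-product y []       = refl
  into-product y (x ∷ xs) = trans (cong (into y) (rows x xs (allFin l)))
    (trans (into-++ y (map (x ,_) fs) _) (trans (cong (into y (map (x ,_) fs) +_) (into-product y xs)) head-case))
    where
    fs : List (Fin l)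
    fs = filter (λ y → 0# ⊏? F x y) (allFin l)
    head-case : into y (map (x ,_) fs) + length (filter (λ x → 0# ⊏? F x y) xs) ≡
                length (filter (λ x → 0# ⊏? F x y) (x ∷ xs))
    n : ℕ
    n = length (filter (λ x → 0# ⊏? F x y) xs)
    head-case = case 0# ⊏? F x y of λ where
      (yes pos) → trans (cong (_+ n) (into-row-present x fs (Unique.filter⁺ (λ y → 0# ⊏? F x y) (Unique.allFin⁺ l))
                                        (∈-filter⁺ (λ y → 0# ⊏? F x y) (∈-allFin y) pos)))
                        (sym (cong length (List.filter-accept (λ x → 0# ⊏? F x y) pos)))
      (no ¬pos) → trans (cong (_+ n) (into-row-absent x fs (All.tabulate λ y∈ eq →
                          ¬pos (subst (λ y → 0# ⊏ F x y) (sym eq)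
                            (proj₂ (∈-filter⁻ (λ y → 0# ⊏? F x y) {xs = allFin l} y∈))))))
                        (sym (cong length (List.filter-reject (λ x → 0# ⊏? F x y) ¬pos)))

  into-positives : ∀ y → into y (positives F) ≡ length (filter (λ x → 0# ⊏? F x y) (allFin k))
  into-positives y = into-product y (allFin k)

-- The program

pattern #a = 4
pattern #b = 5
pattern #c = 6
pattern #d = 7
pattern #i = 8
pattern #j = 9
pattern #maxs = 10
pattern #mins = 11
pattern #z = 12
pattern #e = 13
pattern #v = 14

pattern upHead = 8
pattern upNext = 9
pattern downHead = 10
pattern downNext = 11
pattern maxStack = 12
pattern minStack = 13

-- Register `#e` holds a position plus one, the format of chain links, and hence is always read
-- through `dec`. To share this code, `edgeCmd` increments its bare position first.
finishCmd : VExp → Cmd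
finishCmd v =
  (Mmaxᵛ [ var #v ]:=ᵛ v) ⨾
  (edgeDoneᵃ [ dec (var #e) ]:= lit 1) ⨾
  (countᵃ [ var #v ]:= dec (countᵃ [ var #v ])) ⨾
  cond ((countᵃ [ var #v ]) == lit 0)
    ((maxStack [ var #maxs ]:= var #v) ⨾ (#maxs := inc (var #maxs)))
    skip

relaxCmd visitCmd minCmd maxCmd edgeCmd : Cmd
relaxCmd =
  (#v := (downTgt [ dec (var #e) ])) ⨾
  cond (((doneᵃ [ var #v ]) == lit 0) && neg ((downᵛ [ dec (var #e) ]) ≼ (Mmaxᵛ [ var #z ])))
    ((Mminᵛ [ var #v ]:=ᵛ (Mmaxᵛ [ var #z ])) ⨾
     (minStack [ var #mins ]:= var #v) ⨾ (#mins := inc (var #mins)))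
    skip ⨾
  (#e := (downNext [ dec (var #e) ]))
visitCmd =
  (#v := (upTgt [ dec (var #e) ])) ⨾
  cond ((edgeDoneᵃ [ dec (var #e) ]) == lit 0) (finishCmd (Mminᵛ [ var #z ])) skip ⨾
  (#e := (upNext [ dec (var #e) ]))
minCmd =
  cond ((doneᵃ [ var #z ]) == lit 0)
    ((#e := (upHead [ var #z ])) ⨾ while (lit 0 << var #e) visitCmd ⨾ (doneᵃ [ var #z ]:= lit 1))
    skip
maxCmd =
  (#maxs := dec (var #maxs)) ⨾ (#z := (maxStack [ var #maxs ])) ⨾
  (#e := (downHead [ var #z ])) ⨾ while (lit 0 << var #e) relaxCmd
edgeCmd =
  (#v := (upTgt [ var #j ])) ⨾ (#e := inc (var #j)) ⨾ (#j := inc (var #j)) ⨾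
  cond ((edgeDoneᵃ [ dec (var #e) ]) == lit 0) (finishCmd (upᵛ [ dec (var #e) ])) skip

popMinCmd nextNodeCmd : Cmd
popMinCmd   = (#mins := dec (var #mins)) ⨾ (#z := (minStack [ var #mins ]))
nextNodeCmd = (#z := (order [ var #i ])) ⨾ (#i := inc (var #i))

-- The merge of the two sorted lists; on equal keys the node goes first. Reads beyond the end of a
-- list are harmless, as the range test in the same conjunction is then false.
edgeEarlier nodeFirst : Test
edgeEarlier = (var #j << var #up) && neg ((limitᵛ [ order [ var #i ] ]) ≼ (upᵛ [ var #j ]))
nodeFirst   = (var #i << var #min) && neg edgeEarlier

-- Memory starts out as zero and `0#`, so flags and max-node marks already have their initial
-- values. The body turns to the sorted lists only when both stacks are empty, since a stacked node
-- always has a least key.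
program : Program
program = record
  { init =
      while (var #a << var #min)
        ((Mminᵛ [ var #a ]:=ᵛ (limitᵛ [ var #a ])) ⨾ (#a := inc (var #a))) ⨾
      while (var #b << var #up)
        ((countᵃ [ upTgt [ var #b ] ]:= inc (countᵃ [ upTgt [ var #b ] ])) ⨾
         (upNext [ var #b ]:= (upHead [ upSrc [ var #b ] ])) ⨾
         (upHead [ upSrc [ var #b ] ]:= inc (var #b)) ⨾ (#b := inc (var #b))) ⨾
      while (var #c << var #down)
        ((downNext [ var #c ]:= (downHead [ downSrc [ var #c ] ])) ⨾
         (downHead [ downSrc [ var #c ] ]:= inc (var #c)) ⨾ (#c := inc (var #c))) ⨾
      while (var #d << var #max)
        (cond ((countᵃ [ var #d ]) == lit 0)
           ((maxStack [ var #maxs ]:= var #d) ⨾ (#maxs := inc (var #maxs)))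
           skip ⨾
         (#d := inc (var #d)))
  ; guard = neg ((var #maxs == lit 0) && ((var #mins == lit 0) &&
              (neg (var #i << var #min) && neg (var #j << var #up))))
  ; body =
      cond (lit 0 << var #maxs) maxCmd
        (cond (lit 0 << var #mins) (popMinCmd ⨾ minCmd)
          (cond nodeFirst (nextNodeCmd ⨾ minCmd) edgeCmd))
  }

-- Stacks of nodes in arrays.

module _ {n : ℕ} {K : Set a} where

  -- Keys are ghost data: the array stores nodes alone, and the key identifies the occurrence in the
  -- abstract queue.
  data Stack (arr : ℕ → ℕ) : ℕ → List (Fin n × K) → Set a where
    []   : Stack arr 0 []
    push : ∀ {m x k xs} → arr m ≡ toℕ x → Stack arr m xs → Stack arr (suc m) ((x , k) ∷ xs)

  Stack-update : ∀ {arr m m′ v xs} → m ≤ m′ → Stack arr m xs → Stack (update ℕ._≟_ m′ v arr) m xs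
  Stack-update m≤m′ []            = []
  Stack-update {arr} m<m′ (push eq stk) =
    push (trans (update-other ℕ._≟_ _ arr _ (ℕ.<⇒≢ m<m′)) eq) (Stack-update (ℕ.<⇒≤ m<m′) stk)

  Stack-push : ∀ {arr m v x k xs} → v ≡ toℕ x → Stack arr m xs →
               Stack (update ℕ._≟_ m v arr) (suc m) ((x , k) ∷ xs)
  Stack-push {arr} {m} v≡x stk = push (trans (update-same ℕ._≟_ m arr) v≡x) (Stack-update ℕ.≤-refl stk)

  Stack-empty : ∀ {arr m xs} → Stack arr m xs → (m ≡ᵇ 0) ≡ null xs
  Stack-empty []         = refl
  Stack-empty (push _ _) = refl

  Stack-nonempty : ∀ {arr m xs} → Stack arr m xs → (0 <ᵇ m) ≡ not (null xs)
  Stack-nonempty []         = refl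
  Stack-nonempty (push _ _) = refl

  Stack-pop : ∀ {arr m x k xs} → Stack arr m ((x , k) ∷ xs) →
              arr (pred m) ≡ toℕ x × Stack arr (pred m) xs
  Stack-pop (push eq stk) = eq , stk

-- Simulation of the algorithm on the machine.

module Machine {c ℓ₁ ℓ₂} (chain : BoundedChain c ℓ₁ ℓ₂) {N : Minimax.Net chain}
               (I : Minimax.SortedInput chain N) where
  open Gödel chain
  open Correctness chain N
  open SortedInput I

  module Up   = Positive chain E⁻⁺
  module Down = Positive chain E⁺⁻

  up-unique : Unique up
  up-unique = Unique-↭ (↭-sym up-all) Up.positives-unique

  occurrences : List (Vmax × Carrier) → List (Vmin × Carrier) → List Vmin → List (Vmin × Vmax) →
                List Occurrence
  occurrences maxs mins ns es =
    map (λ (y , k) → node (inj₂ y) , k) maxs ++ (map (λ (x , k) → node (inj₁ x) , k) mins ++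
      (map (λ x → node (inj₁ x) , L x) ns ++ map (λ (z , y) → edge z y , E⁻⁺ z y) es))

  -- The queue is split into two stacks of nodes inserted by the main loop and
  -- the unread parts of the two sorted input lists.  An inserted node has the
  -- key that was extracted last, so it may be extracted before the others.
  record Sim (σ : Store) (ℓ : Carrier) (s : State) (maxs : List (Vmax × Carrier))
             (mins : List (Vmin × Carrier)) (ns : List Vmin) (es : List (Vmin × Vmax)) :
             Set (c ⊔ ℓ₂) where
    field
      M-min     : ∀ x → vals σ Mminᵛ (toℕ x) ≡ M s (inj₁ x)
      M-max     : ∀ y → vals σ Mmaxᵛ (toℕ y) ≡ M s (inj₂ y)
      done≡     : ∀ x → nats σ doneᵃ (toℕ x) ≡ bit (done s x)
      edgeDone≡ : ∀ {i e} → At up i e → nats σ edgeDoneᵃ i ≡ bit (edgeDone s e)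
      count≡    : ∀ y → nats σ countᵃ (toℕ y) ≡ count s y
      #min≡     : reg σ #min ≡ p
      #up≡      : reg σ #up ≡ length up
      order≡    : ∀ {i x} → At nodes i x → nats σ order i ≡ toℕ x
      limit≡    : ∀ x → vals σ limitᵛ (toℕ x) ≡ L x
      upTgt≡    : ∀ {i z y} → At up i (z , y) → nats σ upTgt i ≡ toℕ y
      up≡       : ∀ {i z y} → At up i (z , y) → vals σ upᵛ i ≡ E⁻⁺ z y
      downTgt≡  : ∀ {i z x} → At down i (z , x) → nats σ downTgt i ≡ toℕ x
      down≡     : ∀ {i z x} → At down i (z , x) → vals σ downᵛ i ≡ E⁺⁻ z x
      upAdj     : ∀ z → ∃[ ys ] Chain up (nats σ upNext) z (length up) (nats σ upHead (toℕ z)) ys ×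
                                ys ↭ succ⁻ z
      downAdj   : ∀ z → ∃[ xs ] Chain down (nats σ downNext) z (length down) (nats σ downHead (toℕ z)) xs ×
                                xs ↭ succ⁺ z
      maxStk    : Stack (nats σ maxStack) (reg σ #maxs) maxs
      minStk    : Stack (nats σ minStack) (reg σ #mins) mins
      nodesLeft : Suffix nodes (reg σ #i) ns
      edgesLeft : Suffix up (reg σ #j) es
      queue     : Q s ↭ occurrences maxs mins ns es
      maxs⊑     : All (λ o → proj₂ o ⊑ ℓ) maxs
      mins⊑     : All (λ o → proj₂ o ⊑ ℓ) mins

  record Exec {r} (C : Cmd) (σ : Store) (bound : ℕ) (Post : Store → Set r) : Set (c ⊔ r) where
    constructor exec
    field
      {time}  : ℕ
      {final} : Store
      run     : ⟨ C , σ ⟩⇓[ time ] final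
      fast    : time ≤ bound
      post    : Post final

  settle-sim : ∀ {σ ℓ s maxs mins ns es z y i a} → Sim σ ℓ s maxs mins ns es → At up i (z , y) →
               reg σ #v ≡ toℕ y → reg σ #e ≡ suc i →
               Sim (setNat countᵃ (reg σ #v) (pred (nats σ countᵃ (reg σ #v)))
                     (setNat edgeDoneᵃ (pred (reg σ #e)) 1 (setVal Mmaxᵛ (reg σ #v) a σ)))
                   ℓ (settle z y a s) maxs mins ns es
  settle-sim {σ} {s = s} {z = z} {y} {i} {a} sim at v≡y e≡i = record
    { Sim sim
    ; M-max     = λ y′ → update-sim ℕ._≟_ _≟V_ id (vals σ Mmaxᵛ) (M s)
                    (λ eq → cong inj₂ (Fin.toℕ-injective (trans eq v≡y))) (λ { refl → sym v≡y })
                    refl (M-max y′)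
    ; edgeDone≡ = λ at′ → update-sim ℕ._≟_ _≟E_ bit (nats σ edgeDoneᵃ) (edgeDone s)
                    (λ eq → At-functional at′ (subst (λ i → At up i (z , y)) (sym (trans eq (cong pred e≡i))) at))
                    -- Flags are indexed by position; as `up` has no duplicates, the written
                    -- position is the only one carrying this edge.
                    (λ { refl → trans (At-injective up-unique at′ at) (cong pred (sym e≡i)) })
                    refl (edgeDone≡ at′)
    ; count≡    = λ y′ → update-sim ℕ._≟_ Fin._≟_ id (nats σ countᵃ) (count s)
                    (λ eq → Fin.toℕ-injective (trans eq v≡y)) (λ { refl → sym v≡y })
                    (cong pred (trans (cong (nats σ countᵃ) v≡y) (count≡ y))) (count≡ y′)
    }
    where open Sim sim

  pushMax-sim : ∀ {σ ℓ s maxs mins ns es y} → Sim σ ℓ s maxs mins ns es → reg σ #v ≡ toℕ y →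
                M s (inj₂ y) ⊑ ℓ →
                Sim (setReg #maxs (suc (reg σ #maxs)) (setNat maxStack (reg σ #maxs) (reg σ #v) σ))
                    ℓ (insert (inj₂ y) s) ((y , M s (inj₂ y)) ∷ maxs) mins ns es
  pushMax-sim sim v≡y M⊑ℓ = record
    { Sim sim
    ; maxStk = Stack-push v≡y maxStk
    ; queue  = prep _ queue
    ; maxs⊑  = M⊑ℓ ∷ maxs⊑
    }
    where open Sim sim

  -- What the surrounding chain traversal needs to survive `finishCmd`.
  Frame : Store → Store → Set
  Frame σ σ′ = reg σ′ #z ≡ reg σ #z × reg σ′ #e ≡ reg σ #e × (∀ i → nats σ′ upNext i ≡ nats σ upNext i)

  nonzero : ∀ {n} → n ≢ 0 → (n ≡ᵇ 0) ≡ false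
  nonzero {zero}  n≢0 = contradiction refl n≢0
  nonzero {suc _} _   = refl

  finish-run : ∀ {σ ℓ s maxs mins ns es z y i v a} → Sim σ ℓ s maxs mins ns es → At up i (z , y) →
               reg σ #v ≡ toℕ y → reg σ #e ≡ suc i → ⟦ v ⟧ᵛ σ ≡ a → a ⊑ ℓ →
               Exec (finishCmd v) σ 6 λ σ′ →
                 (∃[ maxs′ ] Sim σ′ ℓ (finishEdge z y a s) maxs′ mins ns es) × Frame σ σ′
  finish-run {σ} {ℓ} {s} {maxs} {mins} {ns} {es} {z} {y} {i} {v} {a} sim at v≡y e≡i refl a⊑ℓ =
    finishEdge-elim z y a s
      (λ s″ → Exec (finishCmd v) σ 6 λ σ′ → (∃[ maxs′ ] Sim σ′ ℓ s″ maxs′ mins ns es) × Frame σ σ′)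
      (λ eq → exec (seq storeᵛ (seq store (seq store (if-true (test (cong (_≡ᵇ 0) eq)) (seq store assign)))))
                ℕ.≤-refl
                ((_ , pushMax-sim sim′ v≡y
                   (subst (_⊑ ℓ) (sym (update-same _≟V_ (inj₂ y) (M s))) a⊑ℓ)) , refl , refl , λ _ → refl))
      (λ neq → exec (seq storeᵛ (seq store (seq store (if-false (test (nonzero neq)) skip))))
                 (ℕ.n≤1+n 5) ((_ , sim′) , refl , refl , λ _ → refl))
    where
    σ₃ : Store
    σ₃ = setNat countᵃ (reg σ #v) (pred (nats σ countᵃ (reg σ #v)))
           (setNat edgeDoneᵃ (pred (reg σ #e)) 1 (setVal Mmaxᵛ (reg σ #v) a σ))
    sim′ : Sim σ₃ ℓ (settle z y a s) maxs mins ns es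
    sim′ = settle-sim sim at v≡y e≡i
    test : ∀ {b} → (count (settle z y a s) y ≡ᵇ 0) ≡ b → (nats σ₃ countᵃ (reg σ #v) ≡ᵇ 0) ≡ b
    test eq = trans (cong (_≡ᵇ 0) (trans (cong (nats σ₃ countᵃ) v≡y) (Sim.count≡ sim′ y))) eq

  bit-false : ∀ {n b} → n ≡ bit b → b ≡ false → (n ≡ᵇ 0) ≡ true
  bit-false refl refl = refl

  bit-true : ∀ {n b} → n ≡ bit b → b ≡ true → (n ≡ᵇ 0) ≡ false
  bit-true refl refl = refl

  set-v : ∀ {σ ℓ s maxs mins ns es n} → Sim σ ℓ s maxs mins ns es → Sim (setReg #v n σ) ℓ s maxs mins ns es
  set-v sim = record { Sim sim }

  set-e : ∀ {σ ℓ s maxs mins ns es n} → Sim σ ℓ s maxs mins ns es → Sim (setReg #e n σ) ℓ s maxs mins ns es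
  set-e sim = record { Sim sim }

  -- Nine steps: two assignments, one test and at most six for settling the edge.
  visit-run : ∀ {σ ℓ s maxs mins ns es z y i} → Sim σ ℓ s maxs mins ns es → At up i (z , y) →
              reg σ #z ≡ toℕ z → reg σ #e ≡ suc i → M s (inj₁ z) ⊑ ℓ →
              Exec visitCmd σ 9 λ σ′ → (∃[ maxs′ ] Sim σ′ ℓ (visit z s y) maxs′ mins ns es) ×
                reg σ′ #z ≡ toℕ z × reg σ′ #e ≡ nats σ upNext i × (∀ j → nats σ′ upNext j ≡ nats σ upNext j)
  visit-run {σ} {ℓ} {s} {maxs} {mins} {ns} {es} {z} {y} {i} sim at z≡ e≡i M⊑ℓ = visit-elim z s y
    (λ s″ → Exec visitCmd σ 9 λ σ′ → (∃[ maxs′ ] Sim σ′ ℓ s″ maxs′ mins ns es) ×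
       reg σ′ #z ≡ toℕ z × reg σ′ #e ≡ nats σ upNext i × (∀ j → nats σ′ upNext j ≡ nats σ upNext j))
    (λ fresh → case finish-run {v = Mminᵛ [ var #z ]} (set-v sim) at v≡y e≡i a≡ M⊑ℓ of λ where
      (exec {final = σ″} run fast ((maxs′ , sim′) , z≡′ , e≡′ , next)) →
        exec (seq assign (seq (if-true (bit-false edge≡ fresh) run) assign))
          (s≤s (s≤s (ℕ.+-monoˡ-≤ 1 fast)))
          ((maxs′ , set-e sim′) , trans z≡′ z≡ ,
           trans (cong (λ j → nats σ″ upNext (pred j)) (trans e≡′ e≡i)) (next i) , next))
    (λ old → exec (seq assign (seq (if-false (bit-true edge≡ old) skip) assign)) (ℕ.m≤m+n 4 5)
      ((maxs , set-e (set-v sim)) , z≡ , cong (λ j → nats σ upNext (pred j)) e≡i , λ _ → refl))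
    where
    open Sim sim
    v≡y : nats σ upTgt (pred (reg σ #e)) ≡ toℕ y
    v≡y = trans (cong (λ j → nats σ upTgt (pred j)) e≡i) (upTgt≡ at)
    edge≡ : nats σ edgeDoneᵃ (pred (reg σ #e)) ≡ bit (edgeDone s (z , y))
    edge≡ = trans (cong (λ j → nats σ edgeDoneᵃ (pred j)) e≡i) (edgeDone≡ at)
    a≡ : vals σ Mminᵛ (reg σ #z) ≡ M s (inj₁ z)
    a≡ = trans (cong (vals σ Mminᵛ) z≡) (M-min z)

  -- The invariant accompanies the run so that `visit-one` can guarantee an unchanged mark and flag
  -- of `z` from one round to the next.
  visit-loop : ∀ {cur σ ℓ s maxs mins ns es z n} ys → Sim σ ℓ s maxs mins ns es → Inv cur ℓ s →
               Chain up (nats σ upNext) z n (reg σ #e) ys → reg σ #z ≡ toℕ z →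
               done s z ≡ false → M s (inj₁ z) ⊑ ℓ → All (λ y → 0# ⊏ E⁻⁺ z y) ys →
               Exec (while (lit 0 << var #e) visitCmd) σ (suc (10 * length ys)) λ σ′ →
                 (∃[ maxs′ ] Sim σ′ ℓ (foldl (visit z) s ys) maxs′ mins ns es) × reg σ′ #z ≡ toℕ z
  visit-loop {σ = σ} ys sim inv chain z≡ undone M⊑ℓ pos with reg σ #e in e≡
  visit-loop []       sim inv nil z≡ undone M⊑ℓ [] | zero =
    exec (while-false (cong (0 <ᵇ_) e≡)) ℕ.≤-refl ((_ , sim) , z≡)
  visit-loop {ℓ = ℓ} {z = z} (y ∷ ys) sim inv (link at _ rest) z≡ undone M⊑ℓ (pos ∷ poss) | suc i
    with visit-run sim at z≡ e≡ M⊑ℓ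
  ... | exec run fast ((_ , sim′) , z≡′ , e≡′ , next)
    with visit-loop ys sim′ first.inv (Chain-head (sym e≡′) (Chain-cong next rest)) z≡′
           (trans (cong (λ d → d z) first.same-done) undone) (subst (_⊑ ℓ) (sym first.same⁻) M⊑ℓ) poss
    where module first = Visited (visit-one inv undone M⊑ℓ pos)
  ...   | exec runs fasts post =
    exec (while-true (cong (0 <ᵇ_) e≡) run runs) (loop-bound 9 (length ys) fast fasts) post

  relax-run : ∀ {σ ℓ s maxs mins ns es z x i} → Sim σ ℓ s maxs mins ns es → At down i (z , x) →
              reg σ #z ≡ toℕ z → reg σ #e ≡ suc i → M s (inj₂ z) ⊑ ℓ →
              Exec relaxCmd σ 6 λ σ′ → (∃[ mins′ ] Sim σ′ ℓ (relax z s x) maxs mins′ ns es) ×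
                reg σ′ #z ≡ toℕ z × reg σ′ #e ≡ nats σ downNext i × (∀ j → nats σ′ downNext j ≡ nats σ downNext j)
  relax-run {σ} {ℓ} {s} {maxs} {mins} {ns} {es} {z} {x} {i} sim at z≡ e≡i M⊑ℓ =
    relax-elim z s x (λ s″ → Exec relaxCmd σ 6 (Post s″))
      (λ undone lt → exec
        (seq assign (seq (if-true (trans test≡ (cong₂ _∧_ (cong not undone) (dec-true (_ ⊏? _) lt)))
                            (seq storeᵛ (seq store assign))) assign))
        ℕ.≤-refl ((_ , set-e lowered) , z≡ , next≡ , λ _ → refl))
      (λ is-done → exec (seq assign (seq (if-false (trans test≡ (unlowered is-done)) skip) assign))
        (ℕ.m≤m+n 4 2) ((_ , set-e (set-v sim)) , z≡ , next≡ , λ _ → refl))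
    where
    open Sim sim
    Post : State → Store → Set (c ⊔ ℓ₂)
    Post s″ σ′ = (∃[ mins′ ] Sim σ′ ℓ s″ maxs mins′ ns es) ×
       reg σ′ #z ≡ toℕ z × reg σ′ #e ≡ nats σ downNext i × (∀ j → nats σ′ downNext j ≡ nats σ downNext j)
    v≡x : nats σ downTgt (pred (reg σ #e)) ≡ toℕ x
    v≡x = trans (cong (λ j → nats σ downTgt (pred j)) e≡i) (downTgt≡ at)
    E≡ : vals σ downᵛ (pred (reg σ #e)) ≡ E⁺⁻ z x
    E≡ = trans (cong (λ j → vals σ downᵛ (pred j)) e≡i) (down≡ at)
    M≡ : vals σ Mmaxᵛ (reg σ #z) ≡ M s (inj₂ z)
    M≡ = trans (cong (vals σ Mmaxᵛ) z≡) (M-max z)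
    next≡ : nats σ downNext (pred (reg σ #e)) ≡ nats σ downNext i
    next≡ = cong (λ j → nats σ downNext (pred j)) e≡i
    σ₁ : Store
    σ₁ = setReg #v (nats σ downTgt (pred (reg σ #e))) σ
    test : Test
    test = ((doneᵃ [ var #v ]) == lit 0) && neg ((downᵛ [ dec (var #e) ]) ≼ (Mmaxᵛ [ var #z ]))
    test≡ : ⟦ test ⟧ᵗ σ₁ ≡ not (done s x) ∧ does (M s (inj₂ z) ⊏? E⁺⁻ z x)
    test≡ = cong₂ _∧_
      (trans (cong (_≡ᵇ 0) (trans (cong (nats σ doneᵃ) v≡x) (done≡ x))) (bit-not (done s x)))
      (trans (cong₂ (λ u w → not (does (u ⊑? w))) E≡ M≡) (sym (does-⊏? _ _)))
      where
      bit-not : ∀ b → (bit b ≡ᵇ 0) ≡ not b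
      bit-not false = refl
      bit-not true  = refl
    σ₃ : Store
    σ₃ = setReg #mins (suc (reg σ #mins)) (setNat minStack (reg σ #mins) (nats σ downTgt (pred (reg σ #e)))
           (setVal Mminᵛ (nats σ downTgt (pred (reg σ #e))) (vals σ Mmaxᵛ (reg σ #z)) σ₁))
    lowered : Sim σ₃ ℓ (lower z s x) maxs ((x , M (mark (inj₁ x) (M s (inj₂ z)) s) (inj₁ x)) ∷ mins) ns es
    lowered = record
      { Sim sim
      ; M-min  = λ x′ → update-sim ℕ._≟_ _≟V_ id (vals σ Mminᵛ) (M s)
                   (λ eq → cong inj₁ (Fin.toℕ-injective (trans eq v≡x))) (λ { refl → sym v≡x }) M≡ (M-min x′)
      ; minStk = Stack-push v≡x minStk
      ; queue  = ↭-trans (prep _ queue)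
          (↭-sym (Perm.shift _ (map (λ (y , k) → node (inj₂ y) , k) maxs) _))
      ; mins⊑  = subst (_⊑ ℓ) (sym (update-same _≟V_ (inj₁ x) (M s))) M⊑ℓ ∷ mins⊑
      }
    unlowered : (M s (inj₂ z) ⊏ E⁺⁻ z x → done s x ≡ true) →
                not (done s x) ∧ does (M s (inj₂ z) ⊏? E⁺⁻ z x) ≡ false
    unlowered is-done with M s (inj₂ z) ⊏? E⁺⁻ z x
    ... | yes lt = cong (λ b → not b ∧ true) (is-done lt)
    ... | no  _  = ∧-zeroʳ (not (done s x))

  relax-loop : ∀ {cur σ ℓ s maxs mins ns es z n} xs → Sim σ ℓ s maxs mins ns es → Inv cur ℓ s →
               Chain down (nats σ downNext) z n (reg σ #e) xs → reg σ #z ≡ toℕ z →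
               count s z ≡ 0 → ℓ ⊑ M s (inj₂ z) →
               Exec (while (lit 0 << var #e) relaxCmd) σ (suc (7 * length xs)) λ σ′ →
                 ∃[ mins′ ] Sim σ′ ℓ (foldl (relax z) s xs) maxs mins′ ns es
  relax-loop {σ = σ} xs sim inv chain z≡ cnt ℓ⊑M with reg σ #e in e≡
  relax-loop []       sim inv nil z≡ cnt ℓ⊑M | zero =
    exec (while-false (cong (0 <ᵇ_) e≡)) ℕ.≤-refl (_ , sim)
  relax-loop {ℓ = ℓ} {s} {z = z} (x ∷ xs) sim inv (link at _ rest) z≡ cnt ℓ⊑M | suc i
    with relax-run sim at z≡ e≡ (Inv.max≤ inv z)
  ... | exec run fast ((_ , sim′) , z≡′ , e≡′ , next)
    with relax-loop xs sim′ (relax-inv {x = x} inv cnt ℓ⊑M) (Chain-head (sym e≡′) (Chain-cong next rest)) z≡′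
           (trans (cong (λ f → f z) (relax-count {z} {s} {x})) cnt)
           (subst (ℓ ⊑_) (sym (relax-M⁺ {z} {s} {x} z)) ℓ⊑M)
  ...   | exec runs fasts post =
    exec (while-true (cong (0 <ᵇ_) e≡) run runs) (loop-bound 6 (length xs) fast fasts) post

  finishNode-sim : ∀ {σ ℓ s maxs mins ns es z} → Sim σ ℓ s maxs mins ns es → reg σ #z ≡ toℕ z →
                   Sim (setNat doneᵃ (reg σ #z) 1 σ) ℓ (finishNode z s) maxs mins ns es
  finishNode-sim {σ} {s = s} sim z≡ = record
    { Sim sim
    ; done≡ = λ x → update-sim ℕ._≟_ Fin._≟_ bit (nats σ doneᵃ) (done s)
                (λ eq → Fin.toℕ-injective (trans eq z≡)) (λ { refl → sym z≡ }) refl (done≡ x)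
    }
    where open Sim sim

  -- The abstract step is chosen to match the run: `min-node` accepts the chain found in memory as a
  -- permutation of the successors.
  min-run : ∀ {cur σ ℓ s maxs mins ns es z} → Sim σ ℓ s maxs mins ns es → Inv cur ℓ s →
            reg σ #z ≡ toℕ z → M s (inj₁ z) ⊑ ℓ →
            ∃[ s′ ] Σ[ step ∈ Process (node (inj₁ z)) s s′ ]
              Exec minCmd σ (10 * work step) λ σ′ → ∃[ maxs′ ] Sim σ′ ℓ s′ maxs′ mins ns es
  min-run {σ = σ} {s = s} {z = z} sim inv z≡ M⊑ℓ with done s z in d
  ... | true  = s , min-skip d ,
    exec (if-false (bit-true done-z d) skip) (ℕ.m≤m+n 2 8) (_ , sim)
    where
    done-z : nats σ doneᵃ (reg σ #z) ≡ bit (done s z)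
    done-z = trans (cong (nats σ doneᵃ) z≡) (Sim.done≡ sim z)
  ... | false with Sim.upAdj sim z
  ...   | ys , chain , perm
    with visit-loop ys (set-e {n = nats σ upHead (reg σ #z)} sim) inv
           (Chain-head (cong (nats σ upHead) (sym z≡)) chain) z≡ d M⊑ℓ (succ⁻-positive perm)
  ...     | exec run fast ((maxs′ , sim′) , z≡′) =
    _ , min-node d perm ,
    exec (if-true (bit-false done-z d) (seq assign (seq run store))) bound (maxs′ , finishNode-sim sim′ z≡′)
    where
    done-z : nats σ doneᵃ (reg σ #z) ≡ bit (done s z)
    done-z = trans (cong (nats σ doneᵃ) z≡) (Sim.done≡ sim z)
    bound : suc (1 + (_ + 1)) ≤ 10 * suc (length (succ⁻ z))
    bound = begin
      suc (1 + (_ + 1))                ≤⟨ s≤s (s≤s (ℕ.+-monoˡ-≤ 1 fast)) ⟩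
      3 + (10 * length ys + 1)         ≡⟨ cong (3 +_) (ℕ.+-comm _ 1) ⟩
      4 + 10 * length ys               ≤⟨ ℕ.+-monoˡ-≤ (10 * length ys) (ℕ.m≤m+n 4 6) ⟩
      10 + 10 * length ys              ≡⟨ ℕ.*-suc 10 (length ys) ⟨
      10 * suc (length ys)             ≡⟨ cong (λ n → 10 * suc n) (Perm.↭-length perm) ⟩
      10 * suc (length (succ⁻ z))      ∎
      where open ℕ.≤-Reasoning

  -- One machine iteration as one iteration of the algorithm.

  Suffix-sorted : ∀ {A : Set a} {f : A → Carrier} {xs n ys} → Suffix xs n ys → AllPairs (λ x y → f x ⊑ f y) xs →
                  AllPairs (λ x y → f x ⊑ f y) ys
  Suffix-sorted here        sorted       = sorted
  Suffix-sorted (there suf) (_ ∷ sorted) = Suffix-sorted suf sorted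

  sorted-by : ∀ {A : Set a} (f : A → Carrier) {xs} → Sorted (map f xs) → AllPairs (λ x y → f x ⊑ f y) xs
  sorted-by f sorted = AllPairs.map⁻ (Sorted⇒AllPairs totalOrder sorted)

  length-nodes : length nodes ≡ p
  length-nodes = trans (Perm.↭-length nodes-all) (List.length-tabulate {n = p} id)

  module _ {σ : Store} {ℓ : Carrier} {s : State} {maxs : List (Vmax × Carrier)} {mins : List (Vmin × Carrier)}
           {ns : List Vmin} {es : List (Vmin × Vmax)} (sim : Sim σ ℓ s maxs mins ns es) where
    open Sim sim

    nodes-test : (reg σ #i <ᵇ reg σ #min) ≡ not (null ns)
    nodes-test = trans (cong (reg σ #i <ᵇ_) (trans #min≡ (sym length-nodes))) (Suffix-nonempty nodesLeft)

    edges-test : (reg σ #j <ᵇ reg σ #up) ≡ not (null es)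
    edges-test = trans (cong (reg σ #j <ᵇ_) #up≡) (Suffix-nonempty edgesLeft)

    guard-test : ⟦ Program.guard program ⟧ᵗ σ ≡
                 not (null maxs ∧ (null mins ∧ (not (not (null ns)) ∧ not (not (null es)))))
    guard-test = cong not (cong₂ _∧_ (Stack-empty maxStk) (cong₂ _∧_ (Stack-empty minStk)
      (cong₂ _∧_ (cong not nodes-test) (cong not edges-test))))

    represents : Represents I σ s
    represents = record
      { M-min     = M-min
      ; M-max     = M-max
      ; done≡     = done≡
      ; edgeDone≡ = λ i → edgeDone≡ (At-lookup up i)
      ; count≡    = count≡
      }

  -- Ten steps per unit of work come from `visit-loop`. The five extra ones are the overhead of
  -- fetching an unread min-node, three tests and two assignments; the other branches fit into the
  -- same bound.
  record Iteration (σ : Store) (s : State) : Set (c ⊔ ℓ₁ ⊔ ℓ₂) where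
    field
      {level}   : Carrier
      {next}    : State
      {steps}   : ℕ
      step      : s ⟶ next
      next-inv  : Inv [] level next
      paid      : steps + Φ next ≤ Φ s
      steps>0   : 0 < steps
      execution : Exec (Program.body program) σ (5 + 10 * steps) λ σ′ →
                    ∃[ maxs ] ∃[ mins ] ∃[ ns ] ∃[ es ] Sim σ′ level next maxs mins ns es

  iteration : ∀ {ℓ σ s s′ o k Q′} → Inv [] ℓ s → Q s ↭ (o , k) ∷ Q′ → All (λ occ → k ⊑ proj₂ occ) Q′ →
              (step : Process o (record s { Q = Q′ }) s′) →
              Exec (Program.body program) σ (5 + 10 * work step) (λ σ′ →
                ∃[ maxs ] ∃[ mins ] ∃[ ns ] ∃[ es ] Sim σ′ k s′ maxs mins ns es) →
              Iteration σ s
  iteration inv perm least step execution = record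
    { step      = extract perm least step
    ; next-inv  = proj₁ (step-inv inv perm least step)
    ; paid      = proj₂ (step-inv inv perm least step)
    ; steps>0   = work>0 step
    ; execution = execution
    }

  module _ {ℓ : Carrier} {σ : Store} {s : State} (inv : Inv [] ℓ s) where
    open Inv inv

    -- All queued keys are at least the level, so an occurrence with a key at most the level is
    -- minimal without any search.
    least-dynamic : ∀ {o k Q′} → Q s ↭ (o , k) ∷ Q′ → k ⊑ ℓ → All (λ occ → k ⊑ proj₂ occ) Q′
    least-dynamic perm k⊑ℓ = All.tabulate λ o∈ →
      ⊑-trans k⊑ℓ (keys (Perm.∈-resp-↭ (↭-sym perm) (there o∈)))

    raise : ∀ {A : Set} {o k Q′} {xs : List (A × Carrier)} → Q s ↭ (o , k) ∷ Q′ →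
            All (λ o → proj₂ o ⊑ ℓ) xs → All (λ o → proj₂ o ⊑ k) xs
    raise perm = All.map λ le → ⊑-trans le (keys (Perm.∈-resp-↭ (↭-sym perm) (here refl)))

    iterate-max : ∀ {z k maxs mins ns es} → Sim σ ℓ s ((z , k) ∷ maxs) mins ns es → Iteration σ s
    iterate-max {z} {k} {maxs} {mins} {ns} {es} sim
      with Sim.downAdj sim z | valid _ (Perm.∈-resp-↭ (↭-sym (Sim.queue sim)) (here refl))
    ... | xs , chain , perm | lift (cnt , M≡k) = iteration inv queue least (max-node perm)
      (case relax-loop xs popped (extract-inv inv queue least) (Chain-head (cong (nats σ downHead) (sym top)) chain)
              top cnt (reflexive (Eq.reflexive (sym M≡k))) of λ where
        (exec run fast (mins′ , sim′)) →
          exec (if-true (Stack-nonempty maxStk) (seq assign (seq assign (seq assign run)))) (bound fast)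
            (maxs , mins′ , ns , es , sim′))
      where
      open Sim sim
      top : nats σ maxStack (pred (reg σ #maxs)) ≡ toℕ z
      top = proj₁ (Stack-pop maxStk)
      least : All (λ occ → k ⊑ proj₂ occ) (occurrences maxs mins ns es)
      least = least-dynamic queue (All.head maxs⊑)
      popped : Sim (setReg #e (nats σ downHead (nats σ maxStack (pred (reg σ #maxs))))
                     (setReg #z (nats σ maxStack (pred (reg σ #maxs))) (setReg #maxs (pred (reg σ #maxs)) σ)))
                   k (record s { Q = occurrences maxs mins ns es }) maxs mins ns es
      popped = record
        { Sim sim
        ; maxStk = proj₂ (Stack-pop maxStk)
        ; queue  = ↭-refl
        ; maxs⊑  = raise queue (All.tail maxs⊑)
        ; mins⊑  = raise queue mins⊑
        }
      bound : ∀ {t} → t ≤ suc (7 * length xs) → suc (1 + (1 + (1 + t))) ≤ 5 + 10 * suc (length (succ⁺ z))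
      bound fast rewrite Perm.↭-length perm = ℕ.+-mono-≤ (ℕ.≤-refl {4}) (ℕ.≤-trans fast
        (s≤s (ℕ.*-mono-≤ (ℕ.m≤m+n 7 3) (ℕ.n≤1+n _))))

    iterate-pop : ∀ {z k mins ns es} → Sim σ ℓ s [] ((z , k) ∷ mins) ns es → Iteration σ s
    iterate-pop {z} {k} {mins} {ns} {es} sim =
      case min-run popped (extract-inv inv queue least) top
             (Level.lower (valid _ (Perm.∈-resp-↭ (↭-sym queue) (here refl)))) of λ where
        (s′ , step , exec run fast (maxs′ , sim′)) → iteration inv queue least step
          (exec (if-false (Stack-nonempty maxStk) (if-true (Stack-nonempty minStk) (seq (seq assign assign) run)))
            (ℕ.+-mono-≤ (ℕ.n≤1+n 4) fast) (maxs′ , mins , ns , es , sim′))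
      where
      open Sim sim
      top : nats σ minStack (pred (reg σ #mins)) ≡ toℕ z
      top = proj₁ (Stack-pop minStk)
      least : All (λ occ → k ⊑ proj₂ occ) (occurrences [] mins ns es)
      least = least-dynamic queue (All.head mins⊑)
      popped : Sim (setReg #z (nats σ minStack (pred (reg σ #mins))) (setReg #mins (pred (reg σ #mins)) σ))
                   k (record s { Q = occurrences [] mins ns es }) [] mins ns es
      popped = record
        { Sim sim
        ; minStk = proj₂ (Stack-pop minStk)
        ; queue  = ↭-refl
        ; maxs⊑  = []
        ; mins⊑  = raise queue (All.tail mins⊑)
        }

    -- With both stacks empty the queue consists of the two unread lists. Sortedness compares `x`
    -- with the remaining nodes, and the premise on `es` compares it with the edges.
    iterate-node : ∀ {x ns es} → Sim σ ℓ s [] [] (x ∷ ns) es → All (λ (z , y) → L x ⊑ E⁻⁺ z y) es →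
                   ⟦ nodeFirst ⟧ᵗ σ ≡ true → Iteration σ s
    iterate-node {x} {ns} {es} sim before test =
      case min-run taken (extract-inv inv queue least) top
             (Level.lower (valid _ (Perm.∈-resp-↭ (↭-sym queue) (here refl)))) of λ where
        (s′ , step , exec run fast (maxs′ , sim′)) → iteration inv queue least step
          (exec (if-false (Stack-nonempty maxStk) (if-false (Stack-nonempty minStk)
                   (if-true test (seq (seq assign assign) run))))
            (ℕ.+-monoʳ-≤ 5 fast) (maxs′ , [] , ns , es , sim′))
      where
      open Sim sim
      top : nats σ order (reg σ #i) ≡ toℕ x
      top = order≡ (Suffix-At nodesLeft)
      least : All (λ occ → L x ⊑ proj₂ occ) (occurrences [] [] ns es)
      least = All.++⁺ (All.map⁺ (AllPairs.head (Suffix-sorted nodesLeft (sorted-by L nodes-sort)))) (All.map⁺ before)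
      taken : Sim (setReg #i (suc (reg σ #i)) (setReg #z (nats σ order (reg σ #i)) σ))
                  (L x) (record s { Q = occurrences [] [] ns es }) [] [] ns es
      taken = record
        { Sim sim
        ; nodesLeft = Suffix-next nodesLeft
        ; queue     = ↭-refl
        ; maxs⊑     = []
        ; mins⊑     = []
        }

    module TakeEdge {z : Vmin} {y : Vmax} {ns : List Vmin} {es : List (Vmin × Vmax)}
                    (sim : Sim σ ℓ s [] [] ns ((z , y) ∷ es))
                    (before : All (λ x → E⁻⁺ z y ⊑ L x) ns) where
      open Sim sim
      front : Q s ↭ (edge z y , E⁻⁺ z y) ∷ occurrences [] [] ns es
      front = ↭-trans queue (Perm.shift _ (map (λ x → node (inj₁ x) , L x) ns) _)
      least : All (λ occ → E⁻⁺ z y ⊑ proj₂ occ) (occurrences [] [] ns es)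
      least = All.++⁺ (All.map⁺ before)
        (All.map⁺ (AllPairs.head (Suffix-sorted edgesLeft (sorted-by (λ (z , y) → E⁻⁺ z y) up-sort))))
      taken : Sim (setReg #j (suc (reg σ #j)) (setReg #e (suc (reg σ #j)) (setReg #v (nats σ upTgt (reg σ #j)) σ)))
                  (E⁻⁺ z y) (record s { Q = occurrences [] [] ns es }) [] [] ns es
      taken = record
        { Sim sim
        ; edgesLeft = Suffix-next edgesLeft
        ; queue     = ↭-refl
        ; maxs⊑     = []
        ; mins⊑     = []
        }
      edge≡ : nats σ edgeDoneᵃ (reg σ #j) ≡ bit (edgeDone s (z , y))
      edge≡ = edgeDone≡ (Suffix-At edgesLeft)

    iterate-edge : ∀ {z y ns es} → Sim σ ℓ s [] [] ns ((z , y) ∷ es) → All (λ x → E⁻⁺ z y ⊑ L x) ns →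
                   ⟦ nodeFirst ⟧ᵗ σ ≡ false → Iteration σ s
    iterate-edge {z} {y} {ns} {es} sim before test with edgeDone s (z , y) in d
    ... | true = iteration inv front least (edge-skip d)
      (exec (if-false (Stack-nonempty maxStk) (if-false (Stack-nonempty minStk) (if-false test
              (seq assign (seq assign (seq assign (if-false (bit-true edge≡ d) skip)))))))
        (ℕ.m≤m+n 8 7) ([] , [] , ns , es , taken))
      where
      open Sim sim
      open TakeEdge sim before
    ... | false = case finish-run {v = upᵛ [ dec (var #e) ]} taken (Suffix-At edgesLeft)
                         (upTgt≡ (Suffix-At edgesLeft)) refl (up≡ (Suffix-At edgesLeft)) ⊑-refl of λ where
        (exec run fast ((maxs′ , sim′) , _)) → iteration inv front least (edge-new d)
          (exec (if-false (Stack-nonempty maxStk) (if-false (Stack-nonempty minStk) (if-false test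
                  (seq assign (seq assign (seq assign (if-true (bit-false edge≡ d) run)))))))
            (ℕ.≤-trans (ℕ.+-monoʳ-≤ 7 fast) (ℕ.m≤m+n 13 2)) (maxs′ , [] , ns , es , sim′))
      where
      open Sim sim
      open TakeEdge sim before

    iterate : ∀ maxs mins ns es → Sim σ ℓ s maxs mins ns es →
              not (null maxs ∧ (null mins ∧ (not (not (null ns)) ∧ not (not (null es))))) ≡ true → Iteration σ s
    iterate (_ ∷ _) _       _        _        sim _ = iterate-max sim
    iterate []      (_ ∷ _) _        _        sim _ = iterate-pop sim
    iterate []      []      (_ ∷ _)  []       sim _ =
      iterate-node sim [] (cong₂ (λ u w → u ∧ not (w ∧ not (does (⟦ limitᵛ [ order [ var #i ] ] ⟧ᵛ σ ⊑? ⟦ upᵛ [ var #j ] ⟧ᵛ σ))))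
        (nodes-test sim) (edges-test sim))
    iterate []      []      []       (_ ∷ _)  sim _ =
      iterate-edge sim [] (cong (_∧ not (⟦ edgeEarlier ⟧ᵗ σ)) (nodes-test sim))
    -- The decision is passed on together with an equation, so that its outcome can be related to
    -- the test evaluated by the machine.
    iterate []      []      (x ∷ ns) ((z , y) ∷ es) sim _ = by-key (L x ⊑? E⁻⁺ z y) refl
      where
      open Sim sim
      sorted-nodes : All (λ x′ → L x ⊑ L x′) ns
      sorted-nodes = AllPairs.head (Suffix-sorted nodesLeft (sorted-by L nodes-sort))
      sorted-edges : All (λ (z′ , y′) → E⁻⁺ z y ⊑ E⁻⁺ z′ y′) es
      sorted-edges = AllPairs.head (Suffix-sorted edgesLeft (sorted-by (λ (z , y) → E⁻⁺ z y) up-sort))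
      test : ⟦ nodeFirst ⟧ᵗ σ ≡ not (not (does (L x ⊑? E⁻⁺ z y)))
      test = cong₂ _∧_ (nodes-test sim) (cong not (cong₂ _∧_ (edges-test sim)
        (cong₂ (λ u w → not (does (u ⊑? w)))
          (trans (cong (vals σ limitᵛ) (order≡ (Suffix-At nodesLeft))) (limit≡ x))
          (up≡ (Suffix-At edgesLeft)))))
      by-key : (d : Dec (L x ⊑ E⁻⁺ z y)) → does (L x ⊑? E⁻⁺ z y) ≡ does d → Iteration σ s
      by-key (yes le) eq = iterate-node sim (le ∷ All.map (⊑-trans le) sorted-edges)
        (trans test (cong (λ b → not (not b)) eq))
      by-key (no ¬le) eq = iterate-edge sim (≰⇒≥ ¬le ∷ All.map (⊑-trans (≰⇒≥ ¬le)) sorted-nodes)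
        (trans test (cong (λ b → not (not b)) eq))

  -- The factor 16 is ten per unit of work, plus five for the overhead of an iteration and one for
  -- the loop test; these six are absorbed because every iteration does at least one unit.
  Φ-bound : ∀ {w Φ′ Φ₀ t u} → t ≤ 5 + 10 * w → 0 < w → w + Φ′ ≤ Φ₀ → u ≤ suc (16 * Φ′) →
            suc (t + u) ≤ suc (16 * Φ₀)
  Φ-bound {w} {Φ′} {Φ₀} {t} {u} t≤ 0<w paid u≤ = s≤s (begin
    t + u                             ≤⟨ ℕ.+-mono-≤ t≤ u≤ ⟩
    5 + 10 * w + suc (16 * Φ′)        ≡⟨ ℕ.+-suc (5 + 10 * w) (16 * Φ′) ⟩
    6 + 10 * w + 16 * Φ′              ≤⟨ ℕ.+-monoˡ-≤ (16 * Φ′) (ℕ.+-monoˡ-≤ (10 * w) (ℕ.*-monoʳ-≤ 6 0<w)) ⟩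
    6 * w + 10 * w + 16 * Φ′          ≡⟨ cong (_+ 16 * Φ′) (ℕ.*-distribʳ-+ w 6 10) ⟨
    16 * w + 16 * Φ′                  ≡⟨ ℕ.*-distribˡ-+ 16 w Φ′ ⟨
    16 * (w + Φ′)                     ≤⟨ ℕ.*-monoʳ-≤ 16 paid ⟩
    16 * Φ₀                           ∎)
    where open ℕ.≤-Reasoning

  -- Recursion is on a strict bound for the potential, so the halting run is built while its
  -- abstract counterpart is traced.
  main-loop : ∀ m {ℓ σ s} maxs mins ns es → Φ s < m → Inv [] ℓ s → Sim σ ℓ s maxs mins ns es →
              ∃[ t ] ∃[ σ′ ] Σ[ run ∈ ⟨ while (Program.guard program) (Program.body program) , σ ⟩⇓[ t ] σ′ ]
                (Tracks I s run × t ≤ suc (16 * Φ s))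
  main-loop (suc m) {ℓ} {σ} {s} maxs mins ns es (s≤s Φs≤m) inv sim
    with not (null maxs ∧ (null mins ∧ (not (not (null ns)) ∧ not (not (null es))))) in eq
  ... | false = 1 , σ , while-false (trans (guard-test sim) eq) ,
                (represents sim , lift (drained maxs mins ns es eq (Sim.queue sim))) , s≤s z≤n
    where
    drained : ∀ maxs mins ns es →
              not (null maxs ∧ (null mins ∧ (not (not (null ns)) ∧ not (not (null es))))) ≡ false →
              Q s ↭ occurrences maxs mins ns es → Q s ≡ []
    drained [] [] [] [] _ perm = Perm.↭-empty-inv perm
  ... | true with iterate inv maxs mins ns es sim eq
  ...   | record { next = s′ ; step = step ; next-inv = inv′ ; paid = paid ; steps>0 = steps>0
                 ; execution = exec run fast (maxs′ , mins′ , ns′ , es′ , sim′) }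
    with main-loop m maxs′ mins′ ns′ es′ (ℕ.≤-trans (ℕ.+-monoˡ-≤ _ steps>0) (ℕ.≤-trans paid Φs≤m)) inv′ sim′
  ...     | u , σ′ , runs , tracks , u≤ =
    _ , σ′ , while-true (trans (guard-test sim) eq) run runs ,
    (represents sim , s′ , step , tracks) , Φ-bound fast steps>0 paid u≤

  -- Initialisation of the machine.

  nth-At : ∀ {A : Set a} {B : Set b} {d : B} (f : A → B) {xs i x} → At xs i x → nth d (map f xs) i ≡ f x
  nth-At f here       = refl
  nth-At f (there at) = nth-At f at

  -- A loop rule: the invariant is indexed by the part of a list not read yet, whose length bounds
  -- the number of rounds.
  countdown : ∀ {A : Set a} {k b C} (P : List A → Store → Set r) →
              (∀ {σ x xs} → P (x ∷ xs) σ → ⟦ b ⟧ᵗ σ ≡ true × Exec C σ k (P xs)) →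
              (∀ {σ} → P [] σ → ⟦ b ⟧ᵗ σ ≡ false) →
              ∀ xs {σ} → P xs σ → Exec (while b C) σ (suc (suc k * length xs)) (P [])
  countdown P one stop []       Pσ = exec (while-false (stop Pσ)) (s≤s z≤n) Pσ
  countdown {k = k} P one stop (x ∷ xs) Pσ with one Pσ
  ... | test , exec run fast Pσ′ with countdown P one stop xs Pσ′
  ...   | exec runs fasts done = exec (while-true test run runs) (loop-bound k (length xs) fast fasts) done

  unfed? : ∀ y → Dec (count initial y ≡ 0)
  unfed? y = count initial y ℕ.≟ 0

  -- The lists are the parts of the input that the four initialisation loops
  -- have not read yet.
  record Init (xs : List Vmin) (us : List (Vmin × Vmax)) (ds : List (Vmax × Vmin)) (ys : List Vmax)
              (σ : Store) : Set c where
    field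
      #min≡      : reg σ #min ≡ p
      #max≡      : reg σ #max ≡ q
      #up≡       : reg σ #up ≡ length up
      #down≡     : reg σ #down ≡ length down
      order≡     : ∀ {i x} → At nodes i x → nats σ order i ≡ toℕ x
      limit≡     : ∀ x → vals σ limitᵛ (toℕ x) ≡ L x
      upSrc≡     : ∀ {i z y} → At up i (z , y) → nats σ upSrc i ≡ toℕ z
      upTgt≡     : ∀ {i z y} → At up i (z , y) → nats σ upTgt i ≡ toℕ y
      up≡        : ∀ {i z y} → At up i (z , y) → vals σ upᵛ i ≡ E⁻⁺ z y
      downSrc≡   : ∀ {i z x} → At down i (z , x) → nats σ downSrc i ≡ toℕ z
      downTgt≡   : ∀ {i z x} → At down i (z , x) → nats σ downTgt i ≡ toℕ x
      down≡      : ∀ {i z x} → At down i (z , x) → vals σ downᵛ i ≡ E⁺⁻ z x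
      M-max≡     : ∀ i → vals σ Mmaxᵛ i ≡ 0#
      done≡      : ∀ i → nats σ doneᵃ i ≡ 0
      edgeDone≡  : ∀ i → nats σ edgeDoneᵃ i ≡ 0
      #i≡        : reg σ #i ≡ 0
      #j≡        : reg σ #j ≡ 0
      #mins≡     : reg σ #mins ≡ 0
      xs-left    : Suffix (allFin p) (reg σ #a) xs
      us-left    : Suffix up (reg σ #b) us
      ds-left    : Suffix down (reg σ #c) ds
      ys-left    : Suffix (allFin q) (reg σ #d) ys
      copied     : ∀ x → x ∈ xs ⊎ vals σ Mminᵛ (toℕ x) ≡ L x
      counted    : ∀ y → nats σ countᵃ (toℕ y) + into y us ≡ into y up
      upLinked   : Linked up (nats σ upHead) (nats σ upNext) (reg σ #b) us
      downLinked : Linked down (nats σ downHead) (nats σ downNext) (reg σ #c) ds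
      {stacked}  : List Vmax
      maxStk     : Stack (nats σ maxStack) (reg σ #maxs) (map (_, 0#) stacked)
      unfed      : filter unfed? (allFin q) ↭ stacked ++ filter unfed? ys

  load-init : Init (allFin p) up down (allFin q) (load I)
  load-init = record
    { #min≡ = refl ; #max≡ = refl ; #up≡ = refl ; #down≡ = refl
    ; order≡     = nth-At toℕ
    ; limit≡     = λ x → nth-At L (At-tabulate id x)
    ; upSrc≡     = nth-At (λ (z , y) → toℕ z)
    ; upTgt≡     = nth-At (λ (z , y) → toℕ y)
    ; up≡        = nth-At (λ (z , y) → E⁻⁺ z y)
    ; downSrc≡   = nth-At (λ (z , x) → toℕ z)
    ; downTgt≡   = nth-At (λ (z , x) → toℕ x)
    ; down≡      = nth-At (λ (z , x) → E⁺⁻ z x)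
    ; M-max≡     = λ _ → refl
    ; done≡      = λ _ → refl
    ; edgeDone≡  = λ _ → refl
    ; #i≡ = refl ; #j≡ = refl ; #mins≡ = refl
    ; xs-left = here ; us-left = here ; ds-left = here ; ys-left = here
    ; copied     = inj₁ ∘ ∈-allFin
    ; counted    = λ _ → refl
    ; upLinked   = λ _ → [] , nil , ↭-refl
    ; downLinked = λ _ → [] , nil , ↭-refl
    ; stacked    = []
    ; maxStk     = []
    ; unfed      = ↭-refl
    }

  allFin-test : ∀ {n m k} {xs : List (Fin n)} → m ≡ n → Suffix (allFin n) k xs → (k <ᵇ m) ≡ not (null xs)
  allFin-test {n} {k = k} eq suf =
    trans (cong (k <ᵇ_) (trans eq (sym (List.length-tabulate {n = n} id)))) (Suffix-nonempty suf)

  copy-step : ∀ {σ x xs us ds ys} → Init (x ∷ xs) us ds ys σ →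
              Init xs us ds ys (setReg #a (suc (reg σ #a)) (setVal Mminᵛ (reg σ #a) (vals σ limitᵛ (reg σ #a)) σ))
  copy-step {σ} {x} {xs} init = record
    { Init init
    ; xs-left = Suffix-next xs-left
    ; copied  = copied′
    }
    where
    open Init init
    copied′ : ∀ x′ → x′ ∈ xs ⊎ update ℕ._≟_ (reg σ #a) (vals σ limitᵛ (reg σ #a)) (vals σ Mminᵛ) (toℕ x′) ≡ L x′
    copied′ x′ with copied x′
    ... | inj₁ (there x′∈)  = inj₁ x′∈
    ... | inj₁ (here refl)  = inj₂ (update-elim ℕ._≟_ (reg σ #a) (vals σ Mminᵛ) (toℕ x′) (_≡ L x′)
      (λ eq → trans (cong (vals σ limitᵛ) (sym eq)) (limit≡ x′))
      (λ neq → contradiction (sym (At-allFin (Suffix-At xs-left))) neq))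
    ... | inj₂ M≡L          = inj₂ (update-elim ℕ._≟_ (reg σ #a) (vals σ Mminᵛ) (toℕ x′) (_≡ L x′)
      (λ eq → trans (cong (vals σ limitᵛ) (sym eq)) (limit≡ x′)) (λ _ → M≡L))

  up-step : ∀ {σ e xs us ds ys} → Init xs (e ∷ us) ds ys σ → let i = reg σ #b in
            Init xs us ds ys
              (setReg #b (suc i) (setNat upHead (nats σ upSrc i) (suc i)
                (setNat upNext i (nats σ upHead (nats σ upSrc i))
                  (setNat countᵃ (nats σ upTgt i) (suc (nats σ countᵃ (nats σ upTgt i))) σ))))
  up-step {σ} {z , y} {us = us} init = record
    { Init init
    ; us-left  = Suffix-next us-left
    ; counted  = counted′
    ; upLinked = Linked-step {head = nats σ upHead} (Suffix-At us-left) (upSrc≡ (Suffix-At us-left)) upLinked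
    }
    where
    open Init init
    t : ℕ
    t = nats σ upTgt (reg σ #b)
    t≡y : t ≡ toℕ y
    t≡y = upTgt≡ (Suffix-At us-left)
    counted′ : ∀ y′ → update ℕ._≟_ t (suc (nats σ countᵃ t)) (nats σ countᵃ) (toℕ y′) + into y′ us ≡ into y′ up
    counted′ y′ = update-elim ℕ._≟_ t (nats σ countᵃ) (toℕ y′) (λ n → n + into y′ us ≡ into y′ up)
      -- The edge just read leaves the second summand and enters the counter, so the total is
      -- unchanged.
      (λ eq → case Fin.toℕ-injective (trans eq t≡y) of λ { refl → begin
        suc (nats σ countᵃ t) + into y us              ≡⟨ ℕ.+-suc (nats σ countᵃ t) (into y us) ⟨
        nats σ countᵃ t + suc (into y us)              ≡⟨ cong₂ _+_ (cong (nats σ countᵃ) t≡y) (sym (into-hit z y us)) ⟩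
        nats σ countᵃ (toℕ y) + into y ((z , y) ∷ us)  ≡⟨ counted y ⟩
        into y up                                      ∎ })
      (λ neq → trans (cong (nats σ countᵃ (toℕ y′) +_) (sym (into-miss z {y′ = y} us (λ { refl → neq (sym t≡y) }))))
                 (counted y′))
      where open ≡-Reasoning

  down-step : ∀ {σ e xs us ds ys} → Init xs us (e ∷ ds) ys σ → let i = reg σ #c in
              Init xs us ds ys
                (setReg #c (suc i) (setNat downHead (nats σ downSrc i) (suc i)
                  (setNat downNext i (nats σ downHead (nats σ downSrc i)) σ)))
  down-step {σ} init = record
    { Init init
    ; ds-left    = Suffix-next ds-left
    ; downLinked = Linked-step {head = nats σ downHead} (Suffix-At ds-left) (downSrc≡ (Suffix-At ds-left)) downLinked
    }
    where open Init init

  into-pred : ∀ y → into y up ≡ count initial y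
  into-pred y = trans (into-↭ y up-all) (Up.into-positives y)

  -- Counters are consulted here, so no edge into a max-node may be unread; `counted` then gives the
  -- full in-degree.
  stack-step : ∀ {σ y xs ds ys} → Init xs [] ds (y ∷ ys) σ → 
               Exec (cond ((countᵃ [ var #d ]) == lit 0)
                       ((maxStack [ var #maxs ]:= var #d) ⨾ (#maxs := inc (var #maxs)))
                       skip ⨾ (#d := inc (var #d)))
                    σ 4 (Init xs [] ds ys)
  stack-step {σ} {y} {ys = ys} init with unfed? y
  ... | yes eq = exec (seq (if-true (trans (cong (_≡ᵇ 0) count≡) (cong (_≡ᵇ 0) eq)) (seq store assign)) assign) ℕ.≤-refl
    (record
      { Init init
      ; ys-left = Suffix-next ys-left
      ; stacked = y ∷ stacked
      ; maxStk  = Stack-push d≡y maxStk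
      ; unfed   = ↭-trans (subst (λ fs → filter unfed? (allFin q) ↭ stacked ++ fs) (List.filter-accept unfed? eq) unfed)
                    (Perm.shift y stacked (filter unfed? ys))
      })
    where
    open Init init
    d≡y : reg σ #d ≡ toℕ y
    d≡y = At-allFin (Suffix-At ys-left)
    count≡ : nats σ countᵃ (reg σ #d) ≡ count initial y
    count≡ = trans (cong (nats σ countᵃ) d≡y) (trans (sym (ℕ.+-identityʳ _)) (trans (counted y) (into-pred y)))
  ... | no neq = exec (seq (if-false (trans (cong (_≡ᵇ 0) count≡) (nonzero neq)) skip) assign) (ℕ.n≤1+n 3)
    (record
      { Init init
      ; ys-left = Suffix-next ys-left
      ; unfed   = subst (λ fs → filter unfed? (allFin q) ↭ stacked ++ fs) (List.filter-reject unfed? neq) unfed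
      })
    where
    open Init init
    d≡y : reg σ #d ≡ toℕ y
    d≡y = At-allFin (Suffix-At ys-left)
    count≡ : nats σ countᵃ (reg σ #d) ≡ count initial y
    count≡ = trans (cong (nats σ countᵃ) d≡y) (trans (sym (ℕ.+-identityʳ _)) (trans (counted y) (into-pred y)))

  -- The max-nodes queued at the start have key `0#`, the initial level, so they qualify for the
  -- stack of nodes that may be extracted first.
  initial-sim : ∀ {σ} (init : Init [] [] [] [] σ) →
                Sim σ 0# initial (map (_, 0#) (Init.stacked init)) [] nodes up
  initial-sim {σ} init = record
    { Init init
    ; M-min     = λ x → case copied x of λ { (inj₂ eq) → eq }
    ; M-max     = λ y → M-max≡ (toℕ y)
    ; done≡     = λ x → done≡ (toℕ x)
    ; edgeDone≡ = λ {i} _ → edgeDone≡ i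
    ; count≡    = λ y → trans (sym (ℕ.+-identityʳ _)) (trans (counted y) (into-pred y))
    ; upAdj     = λ z → Product.map₂ (Product.map₂ λ perm →
                    subst (_ ↭_) (Up.targets-positives z) (↭-trans perm (targets-↭ z up-all)))
                    (Linked-complete {head = nats σ upHead} (Suffix-length us-left) upLinked z)
    ; downAdj   = λ z → Product.map₂ (Product.map₂ λ perm →
                    subst (_ ↭_) (Down.targets-positives z) (↭-trans perm (targets-↭ z down-all)))
                    (Linked-complete {head = nats σ downHead} (Suffix-length ds-left) downLinked z)
    ; minStk    = subst (λ m → Stack (nats σ minStack) m []) (sym #mins≡) []
    ; nodesLeft = subst (λ i → Suffix nodes i nodes) (sym #i≡) here
    ; edgesLeft = subst (λ j → Suffix up j up) (sym #j≡) here
    ; queue     = queue′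
    ; maxs⊑     = All.map⁺ (All.universal (λ _ → ⊑-refl) stacked)
    ; mins⊑     = []
    }
    where
    open Init init
    mins : List Occurrence
    mins = map (λ x → node (inj₁ x) , L x) (allFin p)
    maxs : List Occurrence
    maxs = map (λ y → node (inj₂ y) , 0#) (filter unfed? (allFin q))
    unfed′ : filter unfed? (allFin q) ↭ stacked
    unfed′ = subst (_ ↭_) (List.++-identityʳ stacked) unfed
    queue′ : Q initial ↭ occurrences (map (_, 0#) stacked) [] nodes up
    queue′ = ↭-trans (Perm.shifts mins maxs)
      (Perm.++⁺ (subst (maxs ↭_) (List.map-∘ stacked) (Perm.map⁺ _ unfed′))
        (Perm.++⁺ (Perm.map⁺ _ (↭-sym nodes-all)) (Perm.map⁺ _ (↭-sym up-all))))

  init-run : Exec (Program.init program) (load I)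
               (suc (3 * p) + (suc (5 * length up) + (suc (4 * length down) + suc (5 * q))))
               (Init [] [] [] [])
  init-run
    with countdown (λ xs → Init xs up down (allFin q))
           (λ init → allFin-test (Init.#min≡ init) (Init.xs-left init) ,
                     exec (seq storeᵛ assign) ℕ.≤-refl (copy-step init))
           (λ init → allFin-test (Init.#min≡ init) (Init.xs-left init)) (allFin p) load-init
  ... | exec run₁ fast₁ init₁
    with countdown (λ us → Init [] us down (allFin q))
           (λ {σ} init → trans (cong (reg σ #b <ᵇ_) (Init.#up≡ init)) (Suffix-nonempty (Init.us-left init)) ,
                     exec (seq store (seq store (seq store assign))) ℕ.≤-refl (up-step init))
           (λ {σ} init → trans (cong (reg σ #b <ᵇ_) (Init.#up≡ init)) (Suffix-nonempty (Init.us-left init)))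
           up init₁
  ...   | exec run₂ fast₂ init₂
    with countdown (λ ds → Init [] [] ds (allFin q))
           (λ {σ} init → trans (cong (reg σ #c <ᵇ_) (Init.#down≡ init)) (Suffix-nonempty (Init.ds-left init)) ,
                     exec (seq store (seq store assign)) ℕ.≤-refl (down-step init))
           (λ {σ} init → trans (cong (reg σ #c <ᵇ_) (Init.#down≡ init)) (Suffix-nonempty (Init.ds-left init)))
           down init₂
  ...     | exec run₃ fast₃ init₃
    with countdown (λ ys → Init [] [] [] ys)
           (λ init → allFin-test (Init.#max≡ init) (Init.ys-left init) , stack-step init)
           (λ init → allFin-test (Init.#max≡ init) (Init.ys-left init)) (allFin q) init₃
  ...       | exec run₄ fast₄ init₄ =
    exec (seq run₁ (seq run₂ (seq run₃ run₄)))
      (ℕ.+-mono-≤ (ℕ.≤-trans fast₁ (ℕ.≤-reflexive (cong (λ n → suc (3 * n)) (List.length-tabulate {n = p} id))))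
        (ℕ.+-mono-≤ fast₂ (ℕ.+-mono-≤ fast₃
          (ℕ.≤-trans fast₄ (ℕ.≤-reflexive (cong (λ n → suc (5 * n)) (List.length-tabulate {n = q} id)))))))
      init₄

  -- Total running time.

  Φ-initial : Φ initial ≤ 4 * (#edges + #nodes)
  Φ-initial = begin
    Φ initial
      ≡⟨ cong (_+ (R + O)) queue-weight ⟩
    (p + (S + U)) + (R + O)
      -- Queued and reserved max-nodes are each bounded by `W`, the weight of all max-nodes; the
      -- debt of the min-nodes is the number of edges leaving them.
      ≤⟨ ℕ.+-mono-≤ (ℕ.+-monoʳ-≤ p (ℕ.+-monoˡ-≤ U S≤W)) (ℕ.+-mono-≤ R≤W (ℕ.≤-reflexive (Up.length-product (allFin p) (allFin q)))) ⟩
    (p + (W + U)) + (W + U)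
      ≡⟨ cong (λ w → (p + (w + U)) + (w + U)) W≡ ⟩
    (p + ((q + (D + D)) + U)) + ((q + (D + D)) + U)
      -- Padding that evens out the coefficients to 4, which the doubled scans of max-nodes require.
      ≤⟨ ℕ.m≤m+n _ _ ⟩
    (p + ((q + (D + D)) + U)) + ((q + (D + D)) + U) + (3 * p + (2 * q + 2 * U))
      ≡⟨ solve 4 (λ p q u d → (p :+ ((q :+ (d :+ d)) :+ u)) :+ ((q :+ (d :+ d)) :+ u) :+
                    (con 3 :* p :+ (con 2 :* q :+ con 2 :* u)) :≡ con 4 :* ((u :+ d) :+ (p :+ q)))
           refl p q U D ⟩
    4 * (#edges + #nodes) ∎
    where
    open ℕ.≤-Reasoning
    w : Vmax → ℕ
    w y = weight (node (inj₂ y))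
    S R O W U D : ℕ
    S = sum (map w (filter unfed? (allFin q)))
    R = sum (map (reserve (count initial)) (allFin q))
    O = sum (map (owed (done initial)) (allFin p))
    W = sum (map w (allFin q))
    U = length edges⁻⁺
    D = length edges⁺⁻
    S≤W : S ≤ W
    S≤W = sum-map-filter unfed? w (allFin q)
    R≤W : R ≤ W
    R≤W = sum-map-mono (allFin q) λ y → reserve≤ y (count initial y)
      where
      reserve≤ : ∀ y n → (if n ≡ᵇ 0 then 0 else w y) ≤ w y
      reserve≤ y zero    = z≤n
      reserve≤ y (suc _) = ℕ.≤-refl
    W≡ : W ≡ q + (D + D)
    W≡ = trans (sum-map-double (λ y → length (succ⁺ y)) (allFin q))
      (cong₂ (λ n d → n + (d + d)) (List.length-tabulate {n = q} id) (Down.length-product (allFin q) (allFin p)))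
    weights : ∀ {A : Set} (f : A → Occurrence) xs →
              sum (map (weight ∘ proj₁) (map f xs)) ≡ sum (map (weight ∘ proj₁ ∘ f) xs)
    weights f xs = cong sum (sym (List.map-∘ xs))
    mins maxs edges : List Occurrence
    mins  = map (λ x → node (inj₁ x) , L x) (allFin p)
    maxs  = map (λ y → node (inj₂ y) , 0#) (filter unfed? (allFin q))
    edges = map (λ (z , y) → edge z y , E⁻⁺ z y) edges⁻⁺
    sum-split : ∀ xs ys → sum (map (weight ∘ proj₁) (xs ++ ys)) ≡
                sum (map (weight ∘ proj₁) xs) + sum (map (weight ∘ proj₁) ys)
    sum-split xs ys = trans (cong sum (List.map-++ (weight ∘ proj₁) xs ys)) (sum-++ (map (weight ∘ proj₁) xs) _)
    queue-weight : sum (map (weight ∘ proj₁) (Q initial)) ≡ p + (S + U)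
    queue-weight = trans (sum-split mins (maxs ++ edges)) (cong₂ _+_
      (trans (weights _ (allFin p)) (trans (sum-map-one (allFin p)) (List.length-tabulate {n = p} id)))
      (trans (sum-split maxs edges) (cong₂ _+_ (weights _ (filter unfed? (allFin q)))
        (trans (weights _ edges⁻⁺) (sum-map-one edges⁻⁺)))))

  -- The main loop contributes 16 times 4, that is 64, per node or edge, and the initialisation at
  -- most 5. The final tests of the five loops add 5 in total, absorbed into the linear term because
  -- a net is never empty; this makes 74.
  total-bound : ∀ {t u} →
    t ≤ suc (3 * p) + (suc (5 * length up) + (suc (4 * length down) + suc (5 * q))) →
    u ≤ suc (16 * Φ initial) → t + u ≤ 74 * (#edges + #nodes)
  total-bound {t} {u} t≤ u≤ = begin
    t + u
      ≤⟨ ℕ.+-mono-≤ t≤ (ℕ.≤-trans u≤ (s≤s (ℕ.*-monoʳ-≤ 16 Φ-initial))) ⟩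
    suc (3 * p) + (suc (5 * length up) + (suc (4 * length down) + suc (5 * q))) + suc (16 * (4 * (#edges + #nodes)))
      ≡⟨ cong₂ (λ u d → suc (3 * p) + (suc (5 * u) + (suc (4 * d) + suc (5 * q))) + suc (16 * (4 * (#edges + #nodes))))
           (Perm.↭-length up-all) (Perm.↭-length down-all) ⟩
    suc (3 * p) + (suc (5 * U) + (suc (4 * D) + suc (5 * q))) + suc (16 * (4 * (#edges + #nodes)))
      ≤⟨ ℕ.m≤m+n _ (2 * p + D) ⟩
    suc (3 * p) + (suc (5 * U) + (suc (4 * D) + suc (5 * q))) + suc (16 * (4 * (#edges + #nodes))) + (2 * p + D)
      ≡⟨ solve 4 (λ p q u d →
           (con 1 :+ con 3 :* p) :+ ((con 1 :+ con 5 :* u) :+ ((con 1 :+ con 4 :* d) :+ (con 1 :+ con 5 :* q))) :+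
             (con 1 :+ con 16 :* (con 4 :* ((u :+ d) :+ (p :+ q)))) :+ (con 2 :* p :+ d) :≡
           con 5 :+ con 69 :* ((u :+ d) :+ (p :+ q))) refl p q U D ⟩
    5 + 69 * (#edges + #nodes)
      ≤⟨ ℕ.+-monoˡ-≤ (69 * (#edges + #nodes)) (ℕ.*-monoʳ-≤ 5 nonempty) ⟩
    5 * (#edges + #nodes) + 69 * (#edges + #nodes)
      ≡⟨ ℕ.*-distribʳ-+ (#edges + #nodes) 5 69 ⟨
    74 * (#edges + #nodes) ∎
    where
    open ℕ.≤-Reasoning
    U D : ℕ
    U = length edges⁻⁺
    D = length edges⁺⁻
    nonempty : 1 ≤ #edges + #nodes
    nonempty = ℕ.≤-trans (ℕ.>-nonZero⁻¹ p) (ℕ.≤-trans (ℕ.m≤m+n p q) (ℕ.m≤n+m #nodes #edges))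

  implementation : ∃[ t ] ∃[ σ ] Σ[ run ∈ ⟨ Program.command program , load I ⟩⇓[ t ] σ ]
                     (Implements I {program} run × t ≤ 74 * (#edges + #nodes))
  implementation with init-run
  ... | exec run fast init
    with main-loop (suc (Φ initial)) (map (_, 0#) (Init.stacked init)) [] nodes up ℕ.≤-refl initial-inv (initial-sim init)
  ...   | u , σ , runs , tracks , u≤ = _ , σ , seq run runs , tracks , total-bound fast u≤

theorem3p3 : ∀ {c ℓ₁ ℓ₂} (chain : BoundedChain c ℓ₁ ℓ₂) →
    let open Minimax chain hiding (_≤_) in
    (∀ (N : Net) → Algorithm.Returns N (IsGreatestCorrect N))
    ×
    (Σ[ P ∈ Program ] Σ[ k ∈ ℕ ]
    (∀ (N : Net) (I : SortedInput N) →
    ∃[ t ] ∃[ σ ] Σ[ run ∈ ⟨ Program.command P , load I ⟩⇓[ t ] σ ]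
    (Implements I {P} run × t ≤ k * (Net.#edges N + Net.#nodes N))))
theorem3p3 chain =
  Correctness.returns chain , program , 74 , λ N I → Machine.implementation chain I
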